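{- For every $n\ge 7$ with $n\equiv 3\pmod 4$ there exists an integer cyclically $7$-diagonal globally simple $\mathrm{H}_7(n;7)$.
   Context: A partially filled (p.f.) array is a matrix in which some cells may be empty. Let $n\ge k\ge 3$, let $t$ divide $2nk$, put $v=2nk+t$ and let $J$ be the subgroup of $\mathbb{Z}_v$ of order $t$. An $\mathrm{H}_t(n;k)$ (square relative Heffter array) is an $n\times n$ p.f. array with elements in $\mathbb{Z}_v$ such that each row and each column has exactly $k$ filled cells; for every $x\in\mathbb{Z}_v\setminus J$ either $x$ or $-x$ appears in the array; and the elements of every row and column sum to $0$. It is integer if moreover the elements of every row and column, viewed as integers in $\pm\{1,\dots,\lfloor\frac{2nk+t}{2}\rfloor\}$, sum to $0$ in $\mathbb{Z}$. The natural ordering of a row (column) is the ordering of its filled cells from left to right (top to bottom). An ordering $(t_1,\dots,t_\ell)$ of elements of an abelian group is simple if its partial sums $s_i=t_1+\dots+t_i$, $1\le i\le\ell$, are pairwise distinct. The array is globally simple if the natural ordering of each row and each column is simple (partial sums computed in $\mathbb{Z}_v$). For an $n\times n$ array and $i\in\{1,\dots,n\}$, the $i$-th diagonal is $D_i=\{(i,1),(i+1,2),\dots,(i-1,n)\}$, indices taken modulo $n$ in $\{1,\dots,n\}$. Diagonals $D_i,D_{i+1},\dots,D_{i+r}$ (indices mod $n$) are consecutive. A p.f. array of size $n\ge k$ is cyclically $k$-diagonal if its nonempty cells are exactly those of $k$ consecutive diagonals. -}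

module Defs where

open import Data.Fin.Base using (Fin; toℕ; fromℕ<)
open import Data.Fin.Properties using (toℕ<n; toℕ-fromℕ<; toℕ-injective; nonZeroIndex)
open import Data.Integer.Base as ℤ using (ℤ; +_)
open import Data.List.Base using (List; catMaybes; tabulate; foldr; length; take; map)
open import Data.Maybe.Base using (Maybe; just)
open import Data.Maybe using (Is-just)
open import Data.Nat.Base
  using (ℕ; suc; _+_; _*_; _∸_; _≤_; _<_; _≤ᵇ_; _/_; _%_; NonZero; ≢-nonZero⁻¹; ≢-nonZero)
open import Data.Nat.Divisibility
  using (_∣_; divides; ∣m∣n⇒∣m+n; ∣m+n∣m⇒∣n; %-presˡ-∣; _∣0)
open import Data.Nat.DivMod using (_mod_; m/n*n≡m; m*[n/m]≡n; m%n<n)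
open import Data.Nat.Properties
  using (m+n≡0⇒n≡0; m+[n∸m]≡n; *-monoˡ-<; *-cancelʳ-≡; *-cancelʳ-<; ≤-trans; ≤-reflexive; <⇒≤)
open import Data.Product.Base using (Σ-syntax; ∃; ∃-syntax; ∃₂; _×_; _,_)
open import Data.Sum.Base using (_⊎_)
open import Data.Bool.Base using (if_then_else_)
open import Function.Bundles using (_⇔_)
open import Function.Definitions using (Injective)
open import Relation.Binary.PropositionalEquality
  using (_≡_; _≢_; refl; sym; trans; cong; subst)
open import Relation.Nullary.Negation using (¬_)

-- The cyclic group ℤ_v, on the canonical residues 0 , … , v - 1.

ℤ/_ : ℕ → Set
ℤ/ v = Fin v

module _ {v : ℕ} .{{_ : NonZero v}} where

  infixl 6 _⊕_

  𝟘 : ℤ/ v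
  𝟘 = 0 mod v

  _⊕_ : ℤ/ v → ℤ/ v → ℤ/ v
  x ⊕ y = (toℕ x + toℕ y) mod v

  ⊖_ : ℤ/ v → ℤ/ v
  ⊖ x = (v ∸ toℕ x) mod v

  ∑ : List (ℤ/ v) → ℤ/ v
  ∑ = foldr _⊕_ 𝟘

  -- The partial sums are s₁ , … , s_ℓ; the empty sum s₀ is not among them.
  Simple : List (ℤ/ v) → Set
  Simple xs = ∀ i j → 1 ≤ i → i < j → j ≤ length xs → ∑ (take i xs) ≢ ∑ (take j xs)

-- The representative of x in the interval (-v/2 , v/2].  On nonzero x it lies
-- in ±{1 , … , ⌊v/2⌋}, and it is the only one there unless v is even and
-- x = v/2.  For v = 2nk + t neither 0 nor such a v/2 lies outside J, so by
-- counting neither of them occurs in a Heffter array.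
toℤ : ∀ {v} → ℤ/ v → ℤ
toℤ {v} x = if toℕ x ≤ᵇ v / 2 then + toℕ x else + toℕ x ℤ.- + v

∑ℤ : List ℤ → ℤ
∑ℤ = foldr ℤ._+_ ℤ.0ℤ

-- For t ∣ v, the subgroup of ℤ_v of order t: the multiples of v / t.
Subgroup : ∀ (v t : ℕ) .{{_ : NonZero t}} → ℤ/ v → Set
Subgroup v t x = v / t ∣ toℕ x

module _ {v t : ℕ} .{{_ : NonZero v}} .{{_ : NonZero t}} (t∣v : t ∣ v) where

  private
    v/t∣v : v / t ∣ v
    v/t∣v = divides t (sym (m*[n/m]≡n t∣v))

    mod-closed : ∀ m → v / t ∣ m → Subgroup v t (m mod v)
    mod-closed m d = subst (v / t ∣_) (sym (toℕ-fromℕ< (m%n<n m v))) (%-presˡ-∣ d v/t∣v)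

    v/t≢0 : NonZero (v / t)
    v/t≢0 = ≢-nonZero λ eq → ≢-nonZero⁻¹ v (trans (sym (m/n*n≡m t∣v)) (cong (_* t) eq))

    bound : (i : Fin t) → toℕ i * (v / t) < v
    bound i = ≤-trans (*-monoˡ-< (v / t) {{v/t≢0}} (toℕ<n i)) (≤-reflexive (m*[n/m]≡n t∣v))

  Subgroup-𝟘 : Subgroup v t 𝟘
  Subgroup-𝟘 = mod-closed 0 (_ ∣0)

  Subgroup-⊕ : ∀ x y → Subgroup v t x → Subgroup v t y → Subgroup v t (x ⊕ y)
  Subgroup-⊕ x y p q = mod-closed _ (∣m∣n⇒∣m+n p q)

  Subgroup-⊖ : ∀ x → Subgroup v t x → Subgroup v t (⊖ x)
  Subgroup-⊖ x p = mod-closed _ (∣m+n∣m⇒∣n (subst (v / t ∣_) (sym (m+[n∸m]≡n (<⇒≤ (toℕ<n x)))) v/t∣v) p)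

  Subgroup-order : Σ[ f ∈ (Fin t → ℤ/ v) ]
    Injective _≡_ _≡_ f × (∀ x → Subgroup v t x ⇔ (∃[ i ] f i ≡ x))
  Subgroup-order = f , f-injective , λ x → record
    { to        = to x
    ; from      = λ { (i , refl) → divides (toℕ i) (toℕ-fromℕ< (bound i)) }
    ; to-cong   = λ { refl → refl }
    ; from-cong = λ { refl → refl }
    }
    where
    f : Fin t → ℤ/ v
    f i = fromℕ< (bound i)

    f-injective : Injective _≡_ _≡_ f
    f-injective {i} {j} eq = toℕ-injective (*-cancelʳ-≡ (toℕ i) (toℕ j) (v / t) {{v/t≢0}}
      (trans (sym (toℕ-fromℕ< (bound i))) (trans (cong toℕ eq) (toℕ-fromℕ< (bound j)))))

    to : ∀ x → Subgroup v t x → ∃[ i ] f i ≡ x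
    to x (divides q eq) = fromℕ< q<t , toℕ-injective
      (trans (toℕ-fromℕ< (bound (fromℕ< q<t)))
        (trans (cong (_* (v / t)) (toℕ-fromℕ< q<t)) (sym eq)))
      where
      q<t : q < t
      q<t = *-cancelʳ-< (v / t) q t
        (≤-trans (≤-reflexive (cong suc (sym eq)))
          (≤-trans (toℕ<n x) (≤-reflexive (sym (m*[n/m]≡n t∣v)))))

-- `nothing` marks an empty cell.
PFArray : ℕ → Set → Set
PFArray n X = Fin n → Fin n → Maybe X

module _ {n : ℕ} {X : Set} (A : PFArray n X) where

  -- The filled cells of a line, in the natural ordering.
  row : Fin n → List X
  row i = catMaybes (tabulate λ j → A i j)

  column : Fin n → List X
  column j = catMaybes (tabulate λ i → A i j)

  _occurs : X → Set
  x occurs = ∃₂ λ i j → A i j ≡ just x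

-- Rows and columns are numbered from 0, so the diagonal D i consists of the
-- cells (i , 0) , (i + 1 , 1) , …; it depends only on i modulo n.
D : ∀ {n} → ℕ → Fin n → Fin n → Set
D {n} i r c = toℕ r ≡ (i + toℕ c) % n
  where instance _ = nonZeroIndex c

CyclicallyDiagonal : ∀ (k : ℕ) {n} {X : Set} → PFArray n X → Set
CyclicallyDiagonal k {n} A = k ≤ n ×
  ∃ λ (i : Fin n) → ∀ r c → Is-just (A r c) ⇔ (∃[ s ] (s < k × D (toℕ i + s) r c))

modulus : (n k t : ℕ) → ℕ
modulus n k t = 2 * n * k + t

instance
  +-nonZeroʳ : ∀ {m t} .{{_ : NonZero t}} → NonZero (m + t)
  +-nonZeroʳ {m} {t} = ≢-nonZero λ eq → ≢-nonZero⁻¹ t (m+n≡0⇒n≡0 m eq)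

record IsHeffter (n k t : ℕ) .{{_ : NonZero t}} (A : PFArray n (ℤ/ modulus n k t)) : Set where
  J : ℤ/ modulus n k t → Set
  J = Subgroup (modulus n k t) t

  field
    3≤k           : 3 ≤ k
    k≤n           : k ≤ n
    t∣2nk         : t ∣ 2 * n * k
    row-filled    : ∀ i → length (row A i) ≡ k
    column-filled : ∀ j → length (column A j) ≡ k
    -- The two alternatives exclude each other because there are n * k filled
    -- cells and, outside J, n * k pairs ± x.
    covers        : ∀ x → ¬ J x → (A occurs) x ⊎ (A occurs) (⊖ x)
    row-sum       : ∀ i → ∑ (row A i) ≡ 𝟘
    column-sum    : ∀ j → ∑ (column A j) ≡ 𝟘

IsInteger : ∀ {n v} → PFArray n (ℤ/ v) → Set
IsInteger A = (∀ i → ∑ℤ (map toℤ (row A i)) ≡ ℤ.0ℤ)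
            × (∀ j → ∑ℤ (map toℤ (column A j)) ≡ ℤ.0ℤ)

GloballySimple : ∀ {n v} .{{_ : NonZero v}} → PFArray n (ℤ/ v) → Set
GloballySimple A = (∀ i → Simple (row A i)) × (∀ j → Simple (column A j))

{-# OPTIONS --safe #-}

-- Let γ be a function on ℤ_n such that each of c ↦ ∣ γ c ∣ and c ↦ ∣ γ c + γ (c + 2) ∣ takes the
-- values 1 , … , n once, and let φ c ∈ {0 , … , n - 1} be the residue of c.  Put into column c,
-- going down from the main diagonal,
--   - (3n + 2 + φ c) , 2n + 1 + γ c , 4n + 3 + φ c , - (γ c + γ (c + 2)) ,
--   5n + 3 + φ (c + 4) , γ (c + 2) - (2n + 1) , - (6n + 4 + φ (c + 4)) .
-- Columns and rows then sum to 0, and the absolute values run once through 1 , … , 7n + 3 without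
-- the multiples of 2n + 1.  Every diagonal has its entries in an interval (for the central one,
-- in one of two), and these intervals alone keep the sum of each proper cyclic segment of a line,
-- or of its complement, away from the multiples of 14n + 7; so all orderings are simple.
-- For n = 4m + 3, such a γ is a concatenation of two zigzags, read in steps of 2 around ℤ_n.
module Submission where

open import Defs
open import Data.Bool.Base using (true; false; T; if_then_else_)
open import Data.Fin.Base using (Fin; toℕ; fromℕ<)
open import Data.Fin.Properties using (toℕ<n; toℕ-fromℕ<; toℕ-injective)
open import Data.Integer.Base as ℤ using (ℤ; +_; -[1+_]; ∣_∣; +≤+; -≤-; -≤+)
open import Data.Integer.DivMod using (_%ℕ_; _/ℕ_; n%ℕd<d; a≡a%ℕn+[a/ℕn]*n)
import Data.Integer.Properties as ℤ
open import Data.Integer.Tactic.RingSolver using () renaming (solve-∀ to ℤ-solve-∀)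
open import Data.List.Base as List
  using (List; []; _∷_; _++_; take; drop; length; applyUpTo; tabulate; catMaybes)
import Data.List.Properties as List
open import Data.List.Relation.Binary.Pointwise as Pointwise using (Pointwise; []; _∷_)
open import Data.List.Relation.Unary.All using (All; all?; []; _∷_)
import Data.List.Relation.Unary.All.Properties as All
open import Data.List.Relation.Unary.Any as Any using (Any; any?)
open import Data.Maybe using (Is-just)
open import Data.Maybe.Base using (Maybe; just; nothing)
open import Data.Maybe.Relation.Unary.Any using (just)
open import Data.Nat.Base
open import Data.Nat.DivMod
open import Data.Nat.Divisibility using (_∣_; divides; ∣m+n∣m⇒∣n)
import Data.Nat.Properties as ℕ
open import Data.Nat.Tactic.RingSolver using () renaming (solve-∀ to ℕ-solve-∀)
open import Data.Product.Base
open import Data.Sum.Base using (_⊎_; inj₁; inj₂)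
open import Data.Unit.Base using (tt)
open import Function.Base using (_∘_)
open import Function.Bundles using (mk⇔)
open import Relation.Binary.PropositionalEquality
open import Relation.Nullary.Decidable using (Dec; map′; _×-dec_; _⊎-dec_; from-yes)
open import Relation.Nullary.Negation using (¬_; contradiction)

-- Integers modulo v

-- The shifts 2 and 4 are forced by the rows. Within a column diagonals 0 and 2 share one value of
-- `φ`, 4 and 6 another, and the centre cancels the values of `γ` in 1 and 5. Along a row the column
-- changes from cell to cell: diagonal 6 must agree in `φ` with diagonal 2, which is met four
-- columns later, and the two arguments of `γ` in the centre must be those of diagonals 5 and 1, met
-- two columns before and after it. The residue of n modulo 4 comes from γ. The numbers γ c + γ (c +
-- 2) add up to twice the sum of γ, so 1 + ... + n has to be even; for odd n, where steps of 2 run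
-- through ℤ_n in a single cycle, this means n ≡ 3 (mod 4). The intervals are crude, and this shapes
-- the simplicity test. The centre is split by sign because [-n, n] contains 0. Complements are
-- needed too: with a positive centre, diagonals 1 to 4 only give the interval [10n + 8, 15n + 5],
-- which contains 14n + 7, whereas diagonals 5, 6, 0 give [-14n - 5, -10n - 7], which contains no
-- multiple of 14n + 7.

≤-from-difference : ∀ {i j d} → ℤ.0ℤ ℤ.≤ d → j ≡ i ℤ.+ d → i ℤ.≤ j
≤-from-difference {i} {d = + d} _ refl = ℤ.i≤i+j i (+ d)

module _ {v : ℕ} .{{_ : NonZero v}} where

  between-multiples : ∀ q {i} → q ℤ.* + v ℤ.< i → i ℤ.< ℤ.suc q ℤ.* + v →
    ∀ p → i ≢ p ℤ.* + v
  between-multiples q lo hi p refl = ℤ.≤⇒≯ (ℤ.i<j⇒suc[i]≤j q<p) p<1+q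
    where
    q<p : q ℤ.< p
    q<p = ℤ.*-cancelʳ-<-nonNeg (+ v) lo
    p<1+q : p ℤ.< ℤ.suc q
    p<1+q = ℤ.*-cancelʳ-<-nonNeg (+ v) hi

  residue : ℤ → ℤ/ v
  residue z = fromℕ< (n%ℕd<d z v)

  residue-spec : ∀ z → z ≡ + toℕ (residue z) ℤ.+ z /ℕ v ℤ.* + v
  residue-spec z =
    trans (a≡a%ℕn+[a/ℕn]*n z v) (cong (λ r → + r ℤ.+ z /ℕ v ℤ.* + v) (sym (toℕ-fromℕ< (n%ℕd<d z v))))

  residue-≡⇒ : ∀ y z → residue y ≡ residue z → ∃ λ q → y ℤ.- z ≡ q ℤ.* + v
  residue-≡⇒ y z eq = y /ℕ v ℤ.- z /ℕ v , (begin
    y ℤ.- z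
      ≡⟨ cong₂ ℤ._-_ (residue-spec y) (residue-spec z) ⟩
    (+ toℕ (residue y) ℤ.+ y /ℕ v ℤ.* + v) ℤ.- (+ toℕ (residue z) ℤ.+ z /ℕ v ℤ.* + v)
      ≡⟨ cong (λ r → (+ toℕ r ℤ.+ y /ℕ v ℤ.* + v) ℤ.- (+ toℕ (residue z) ℤ.+ z /ℕ v ℤ.* + v)) eq ⟩
    (+ toℕ (residue z) ℤ.+ y /ℕ v ℤ.* + v) ℤ.- (+ toℕ (residue z) ℤ.+ z /ℕ v ℤ.* + v)
      ≡⟨ regroup (+ toℕ (residue z)) (y /ℕ v) (z /ℕ v) (+ v) ⟩
    (y /ℕ v ℤ.- z /ℕ v) ℤ.* + v ∎)
    where
    open ≡-Reasoning
    regroup : ∀ r a b w → (r ℤ.+ a ℤ.* w) ℤ.- (r ℤ.+ b ℤ.* w) ≡ (a ℤ.- b) ℤ.* w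
    regroup = ℤ-solve-∀

  -- Two canonical representatives differ by less than v in either direction, so the coefficient `p`
  -- of their difference satisfies p < 1 and - p < 1.
  residue-unique : ∀ {z} (x : ℤ/ v) q → z ≡ + toℕ x ℤ.+ q ℤ.* + v → residue z ≡ x
  residue-unique {z} x q eq = toℕ-injective (ℤ.+-injective (ℤ.i-j≡0⇒i≡j _ _ (begin
    + toℕ r ℤ.- + toℕ x ≡⟨ difference ⟩
    p ℤ.* + v           ≡⟨ cong (ℤ._* + v) p≡0 ⟩
    ℤ.0ℤ ℤ.* + v        ≡⟨ ℤ.*-zeroˡ (+ v) ⟩
    ℤ.0ℤ                ∎)))
    where
    open ≡-Reasoning
    r = residue z
    p = q ℤ.- z /ℕ v
    isolate : ∀ a b z s q w → a ℤ.- b ≡ (z ℤ.- (b ℤ.+ q ℤ.* w)) ℤ.- (z ℤ.- (a ℤ.+ s ℤ.* w)) ℤ.+ (q ℤ.- s) ℤ.* w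
    isolate = ℤ-solve-∀
    difference : + toℕ r ℤ.- + toℕ x ≡ p ℤ.* + v
    difference = begin
      + toℕ r ℤ.- + toℕ x
        ≡⟨ isolate (+ toℕ r) (+ toℕ x) z (z /ℕ v) q (+ v) ⟩
      (z ℤ.- (+ toℕ x ℤ.+ q ℤ.* + v)) ℤ.- (z ℤ.- (+ toℕ r ℤ.+ z /ℕ v ℤ.* + v)) ℤ.+ p ℤ.* + v
        ≡⟨ cong₂ (λ i j → i ℤ.- j ℤ.+ p ℤ.* + v) (ℤ.i≡j⇒i-j≡0 eq) (ℤ.i≡j⇒i-j≡0 (residue-spec z)) ⟩
      ℤ.0ℤ ℤ.+ p ℤ.* + v
        ≡⟨ ℤ.+-identityˡ _ ⟩
      p ℤ.* + v ∎
    below : ∀ (y z : ℤ/ v) → + toℕ y ℤ.- + toℕ z ℤ.< ℤ.1ℤ ℤ.* + v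
    below y z = ℤ.≤-<-trans (ℤ.i-j≤i (+ toℕ y) (+ toℕ z))
      (subst (+ toℕ y ℤ.<_) (sym (ℤ.*-identityˡ (+ v))) (ℤ.+<+ (toℕ<n y)))
    p<1 : p ℤ.< ℤ.1ℤ
    p<1 = ℤ.*-cancelʳ-<-nonNeg (+ v) (subst (ℤ._< ℤ.1ℤ ℤ.* + v) difference (below r x))
    flip : ∀ a b → b ℤ.- a ≡ ℤ.- (a ℤ.- b)
    flip = ℤ-solve-∀
    -p<1 : ℤ.- p ℤ.< ℤ.1ℤ
    -p<1 = ℤ.*-cancelʳ-<-nonNeg (+ v) (subst (ℤ._< ℤ.1ℤ ℤ.* + v)
      (trans (flip (+ toℕ r) (+ toℕ x)) (trans (cong ℤ.-_ difference) (ℤ.neg-distribˡ-* p (+ v))))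
      (below x r))
    ∣i∣<1⇒i≡0 : ∀ i → i ℤ.< ℤ.1ℤ → ℤ.- i ℤ.< ℤ.1ℤ → i ≡ ℤ.0ℤ
    ∣i∣<1⇒i≡0 (+ zero) _ _ = refl
    ∣i∣<1⇒i≡0 (+ suc _) (ℤ.+<+ (s≤s ())) _
    ∣i∣<1⇒i≡0 -[1+ _ ] _ (ℤ.+<+ (s≤s ()))
    p≡0 : p ≡ ℤ.0ℤ
    p≡0 = ∣i∣<1⇒i≡0 p p<1 -p<1

  residue-toℕ : ∀ x → residue (+ toℕ x) ≡ x
  residue-toℕ x = toℕ-injective (trans (toℕ-fromℕ< _) (m<n⇒m%n≡m (toℕ<n x)))

  residue-≡⇐ : ∀ {y z} q → y ≡ z ℤ.+ q ℤ.* + v → residue y ≡ residue z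
  residue-≡⇐ {y} {z} q eq = residue-unique (residue z) (z /ℕ v ℤ.+ q) (begin
    y                                                     ≡⟨ eq ⟩
    z ℤ.+ q ℤ.* + v                                       ≡⟨ cong (ℤ._+ q ℤ.* + v) (residue-spec z) ⟩
    + toℕ (residue z) ℤ.+ z /ℕ v ℤ.* + v ℤ.+ q ℤ.* + v     ≡⟨ regroup (+ toℕ (residue z)) (z /ℕ v) q (+ v) ⟩
    + toℕ (residue z) ℤ.+ (z /ℕ v ℤ.+ q) ℤ.* + v           ∎)
    where
    open ≡-Reasoning
    regroup : ∀ r a b w → r ℤ.+ a ℤ.* w ℤ.+ b ℤ.* w ≡ r ℤ.+ (a ℤ.+ b) ℤ.* w
    regroup = ℤ-solve-∀

  residue-⊕ : ∀ y z → residue y ⊕ residue z ≡ residue (y ℤ.+ z)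
  residue-⊕ y z = sym (residue-≡⇐ {z = + toℕ (residue y) ℤ.+ + toℕ (residue z)} (y /ℕ v ℤ.+ z /ℕ v) (begin
    y ℤ.+ z
      ≡⟨ cong₂ ℤ._+_ (residue-spec y) (residue-spec z) ⟩
    (+ toℕ (residue y) ℤ.+ y /ℕ v ℤ.* + v) ℤ.+ (+ toℕ (residue z) ℤ.+ z /ℕ v ℤ.* + v)
      ≡⟨ regroup (+ toℕ (residue y)) (y /ℕ v) (+ toℕ (residue z)) (z /ℕ v) (+ v) ⟩
    (+ toℕ (residue y) ℤ.+ + toℕ (residue z)) ℤ.+ (y /ℕ v ℤ.+ z /ℕ v) ℤ.* + v ∎))
    where
    open ≡-Reasoning
    regroup : ∀ r a s b w → (r ℤ.+ a ℤ.* w) ℤ.+ (s ℤ.+ b ℤ.* w) ≡ (r ℤ.+ s) ℤ.+ (a ℤ.+ b) ℤ.* w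
    regroup = ℤ-solve-∀

  ∑-residue : ∀ zs → ∑ (List.map residue zs) ≡ residue (∑ℤ zs)
  ∑-residue [] = refl
  ∑-residue (z ∷ zs) = trans (cong (residue z ⊕_) (∑-residue zs)) (residue-⊕ z (∑ℤ zs))

  ⊖-residue : ∀ x → ⊖ x ≡ residue (ℤ.- + toℕ x)
  ⊖-residue x = residue-≡⇐ {z = ℤ.- + toℕ x} ℤ.1ℤ (begin
    + (v ∸ toℕ x)                ≡⟨ ℤ.⊖-≥ (ℕ.<⇒≤ (toℕ<n x)) ⟨
    v ℤ.⊖ toℕ x                  ≡⟨ ℤ.m-n≡m⊖n v (toℕ x) ⟨
    + v ℤ.- + toℕ x              ≡⟨ regroup (+ v) (+ toℕ x) ⟩
    ℤ.- + toℕ x ℤ.+ ℤ.1ℤ ℤ.* + v ∎)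
    where
    open ≡-Reasoning
    regroup : ∀ w a → w ℤ.- a ≡ ℤ.- a ℤ.+ ℤ.1ℤ ℤ.* w
    regroup = ℤ-solve-∀

-- Simplicity from interval bounds

[1+m*2]/2≡m : ∀ m → suc (m * 2) / 2 ≡ m
[1+m*2]/2≡m m = trans
  (+-distrib-/ 1 (m * 2) (subst (λ r → 1 + r < 2) (sym (m*n%n≡0 m 2)) ℕ.≤-refl))
  (m*n/n≡m m 2)

module _ {v : ℕ} where

  toℤ-≤ : ∀ (x : ℤ/ v) → toℕ x ≤ v / 2 → toℤ x ≡ + toℕ x
  toℤ-≤ x le with toℕ x ≤ᵇ v / 2 in eq
  ... | true  = refl
  ... | false = contradiction (subst T eq (ℕ.≤⇒≤ᵇ le)) λ ()

  toℤ-> : ∀ (x : ℤ/ v) → v / 2 < toℕ x → toℤ x ≡ + toℕ x ℤ.- + v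
  toℤ-> x gt with toℕ x ≤ᵇ v / 2 in eq
  ... | true  = contradiction (ℕ.≤ᵇ⇒≤ (toℕ x) (v / 2) (subst T (sym eq) _)) (ℕ.<⇒≱ gt)
  ... | false = refl

  -- For odd v the range of `toℤ` is the symmetric interval [-m, m]. The integer condition on a line
  -- therefore follows from an integer sum 0 once all entries are bounded by m.
  toℤ-residue : ∀ .{{_ : NonZero v}} m → v ≡ suc (m * 2) →
    ∀ z → ℤ.- + m ℤ.≤ z → z ℤ.≤ + m → toℤ (residue {v} z) ≡ z
  toℤ-residue m refl (+ a) _ (+≤+ a≤m) = trans
    (toℤ-≤ (residue (+ a)) (subst₂ _≤_ (sym a%v≡a) (sym ([1+m*2]/2≡m m)) a≤m))
    (cong +_ a%v≡a)
    where
    a<v : a < v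
    a<v = s≤s (ℕ.≤-trans a≤m (ℕ.m≤m*n m 2))
    a%v≡a : toℕ (residue {v} (+ a)) ≡ a
    a%v≡a = trans (toℕ-fromℕ< _) (m<n⇒m%n≡m a<v)
  toℤ-residue m refl -[1+ a ] lo _ = trans
    (toℤ-> (residue -[1+ a ]) (subst₂ _<_ (sym ([1+m*2]/2≡m m)) (sym toℕ-residue) m<b))
    (trans (cong (λ b → + b ℤ.- + v) toℕ-residue) b-v≡z)
    where
    open ≡-Reasoning
    a<m : suc a ≤ m
    a<m = ℤ.drop‿+≤+ (subst (+ suc a ℤ.≤_) (ℤ.neg-involutive (+ m)) (ℤ.neg-mono-≤ lo))
    b : ℕ
    b = v ∸ suc a
    m<b : m < b
    m<b = ℕ.≤-trans (ℕ.≤-reflexive (sym (ℕ.m+n∸n≡m (suc m) m)))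
      (subst (λ w → suc m + m ∸ m ≤ w ∸ suc a) (cong suc (double m)) (ℕ.∸-monoʳ-≤ (suc m + m) a<m))
      where
      double : ∀ m → m + m ≡ m * 2
      double = ℕ-solve-∀
    b<v : b < v
    b<v = s≤s (ℕ.m∸n≤m (m * 2) a)
    b-v≡z : + b ℤ.- + v ≡ -[1+ a ]
    b-v≡z = begin
      + b ℤ.- + v                  ≡⟨ cong (ℤ._- + v) (ℤ.⊖-≥ a<v) ⟨
      (v ℤ.⊖ suc a) ℤ.- + v        ≡⟨ cong (ℤ._- + v) (ℤ.m-n≡m⊖n v (suc a)) ⟨
      (+ v ℤ.- + suc a) ℤ.- + v    ≡⟨ cancel (+ v) (+ suc a) ⟩
      -[1+ a ]                     ∎
      where
      a<v : suc a ≤ v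
      a<v = ℕ.≤-trans a<m (ℕ.≤-trans (ℕ.m≤m*n m 2) (ℕ.n≤1+n (m * 2)))
      cancel : ∀ w a → (w ℤ.- a) ℤ.- w ≡ ℤ.- a
      cancel = ℤ-solve-∀
    toℕ-residue : toℕ (residue {v} -[1+ a ]) ≡ b
    toℕ-residue = trans (cong toℕ (residue-unique {v} (fromℕ< b<v) ℤ.-1ℤ (begin
      -[1+ a ]                     ≡⟨ b-v≡z ⟨
      + b ℤ.- + v                  ≡⟨ cong₂ (λ i j → + i ℤ.+ j) (toℕ-fromℕ< b<v) (ℤ.-1*i≡-i (+ v)) ⟨
      + toℕ (fromℕ< b<v) ℤ.+ ℤ.-1ℤ ℤ.* + v ∎))) (toℕ-fromℕ< b<v)

∑ℤ-++ : ∀ ys zs → ∑ℤ (ys ++ zs) ≡ ∑ℤ ys ℤ.+ ∑ℤ zs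
∑ℤ-++ [] zs = sym (ℤ.+-identityˡ (∑ℤ zs))
∑ℤ-++ (y ∷ ys) zs = trans (cong (ℤ._+_ y) (∑ℤ-++ ys zs)) (sym (ℤ.+-assoc y (∑ℤ ys) (∑ℤ zs)))

module _ {a} {A : Set a} where

  rotate : ℕ → List A → List A
  rotate k xs = drop k xs ++ take k xs

  take-+ : ∀ i l (xs : List A) → take (i + l) xs ≡ take i xs ++ take l (drop i xs)
  take-+ zero    l xs       = refl
  take-+ (suc i) l []       = sym (List.take-[] l)
  take-+ (suc i) l (x ∷ xs) = cong (x ∷_) (take-+ i l xs)

  length-rotate : ∀ k (xs : List A) → length (rotate k xs) ≡ length xs
  length-rotate k xs = begin
    length (drop k xs ++ take k xs)       ≡⟨ List.length-++ (drop k xs) ⟩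
    length (drop k xs) + length (take k xs) ≡⟨ ℕ.+-comm (length (drop k xs)) _ ⟩
    length (take k xs) + length (drop k xs) ≡⟨ List.length-++ (take k xs) ⟨
    length (take k xs ++ drop k xs)       ≡⟨ cong length (List.take++drop≡id k xs) ⟩
    length xs ∎
    where open ≡-Reasoning

∑ℤ-rotate : ∀ k zs → ∑ℤ (rotate k zs) ≡ ∑ℤ zs
∑ℤ-rotate k zs = begin
  ∑ℤ (drop k zs ++ take k zs)           ≡⟨ ∑ℤ-++ (drop k zs) (take k zs) ⟩
  ∑ℤ (drop k zs) ℤ.+ ∑ℤ (take k zs)     ≡⟨ ℤ.+-comm (∑ℤ (drop k zs)) _ ⟩
  ∑ℤ (take k zs) ℤ.+ ∑ℤ (drop k zs)     ≡⟨ ∑ℤ-++ (take k zs) (drop k zs) ⟨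
  ∑ℤ (take k zs ++ drop k zs)           ≡⟨ cong ∑ℤ (List.take++drop≡id k zs) ⟩
  ∑ℤ zs ∎
  where open ≡-Reasoning

module _ {a b ℓ} {A : Set a} {B : Set b} {R : A → B → Set ℓ} where

  Pointwise-take : ∀ k {xs ys} → Pointwise R xs ys → Pointwise R (take k xs) (take k ys)
  Pointwise-take zero    rs       = []
  Pointwise-take (suc k) []       = []
  Pointwise-take (suc k) (r ∷ rs) = r ∷ Pointwise-take k rs

  Pointwise-drop : ∀ k {xs ys} → Pointwise R xs ys → Pointwise R (drop k xs) (drop k ys)
  Pointwise-drop zero    rs       = rs
  Pointwise-drop (suc k) []       = []
  Pointwise-drop (suc k) (r ∷ rs) = Pointwise-drop k rs

  Pointwise-rotate : ∀ k {xs ys} → Pointwise R xs ys → Pointwise R (rotate k xs) (rotate k ys)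
  Pointwise-rotate k rs = Pointwise.++⁺ (Pointwise-drop k rs) (Pointwise-take k rs)

-- Affine bounds, compared for all n ≥ 7 at once

record Linear : Set where
  constructor _⊹_·n
  field
    constant slope : ℤ
open Linear

infix 5 _⊹_·n

infixl 6 _+ᴸ_
_+ᴸ_ : Linear → Linear → Linear
(a ⊹ b ·n) +ᴸ (c ⊹ d ·n) = (a ℤ.+ c) ⊹ (b ℤ.+ d) ·n

infix 4 _≤ᴸ_ _≤ᴸ?_
-- On [7, ∞) one affine function stays below another exactly when it does so at 7 and has no larger
-- slope. This form is decidable without knowing n.
record _≤ᴸ_ (f g : Linear) : Set where
  constructor _,_
  field
    at-7    : constant f ℤ.+ + 7 ℤ.* slope f ℤ.≤ constant g ℤ.+ + 7 ℤ.* slope g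
    slope-≤ : slope f ℤ.≤ slope g

_≤ᴸ?_ : ∀ f g → Dec (f ≤ᴸ g)
f ≤ᴸ? g = map′ (uncurry _,_) (λ (p , q) → p , q) ((_ ℤ.≤? _) ×-dec (_ ℤ.≤? _))

Interval : Set
Interval = Linear × Linear

∑ᴵ : List Interval → Interval
∑ᴵ = List.foldr (λ (a , b) (c , d) → a +ᴸ c , b +ᴸ d) (zeroᴸ , zeroᴸ)
  where zeroᴸ = ℤ.0ℤ ⊹ ℤ.0ℤ ·n

-- For all n ≥ 7 the interval lies strictly between two consecutive multiples of 14 n + 7.
AvoidsMultiples : Interval → Set
AvoidsMultiples (lo , hi) = Any
  (λ q → (ℤ.1ℤ ℤ.+ q ℤ.* + 7) ⊹ (q ℤ.* + 14) ·n ≤ᴸ lo ×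
         hi ≤ᴸ (q ℤ.* + 7 ℤ.+ + 6) ⊹ (q ℤ.* + 14 ℤ.+ + 14) ·n)
  (-[1+ 1 ] ∷ -[1+ 0 ] ∷ + 0 ∷ + 1 ∷ [])

avoidsMultiples? : ∀ I → Dec (AvoidsMultiples I)
avoidsMultiples? I = any? (λ q → (_ ≤ᴸ? _) ×-dec (_ ≤ᴸ? _)) _

-- In a line with sum 0 it is enough to look at either a segment or its complement.
SegmentsAvoidMultiples : List Interval → Set
SegmentsAvoidMultiples Is = ∀ {i} → i < length Is ∸ 1 → ∀ {l} → l < length Is ∸ suc i →
  AvoidsMultiples (∑ᴵ (take (suc l) (drop (suc i) Is))) ⊎
  AvoidsMultiples (∑ᴵ (take (suc i) Is ++ drop (suc l) (drop (suc i) Is)))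

segmentsAvoidMultiples? : ∀ Is → Dec (SegmentsAvoidMultiples Is)
segmentsAvoidMultiples? Is = ℕ.allUpTo? (λ i → ℕ.allUpTo? (λ l →
  avoidsMultiples? _ ⊎-dec avoidsMultiples? _) (length Is ∸ suc i)) (length Is ∸ 1)

-- Both `k = 0` and `k = length Is` leave the list as it is; admitting both matches the range of
-- rotations in `catMaybes-shifted-band`.
CyclicSegmentsAvoidMultiples : List Interval → Set
CyclicSegmentsAvoidMultiples Is = ∀ {k} → k < suc (length Is) → SegmentsAvoidMultiples (rotate k Is)

cyclicSegmentsAvoidMultiples? : ∀ Is → Dec (CyclicSegmentsAvoidMultiples Is)
cyclicSegmentsAvoidMultiples? Is = ℕ.allUpTo? (λ k → segmentsAvoidMultiples? (rotate k Is)) _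

module _ (n : ℕ) where

  ⟦_⟧ : Linear → ℤ
  ⟦ a ⊹ b ·n ⟧ = a ℤ.+ b ℤ.* + n

  ⟦⟧-+ : ∀ f g → ⟦ f +ᴸ g ⟧ ≡ ⟦ f ⟧ ℤ.+ ⟦ g ⟧
  ⟦⟧-+ (a ⊹ b ·n) (c ⊹ d ·n) = regroup a b c d (+ n)
    where
    regroup : ∀ a b c d w → (a ℤ.+ c) ℤ.+ (b ℤ.+ d) ℤ.* w ≡ (a ℤ.+ b ℤ.* w) ℤ.+ (c ℤ.+ d ℤ.* w)
    regroup = ℤ-solve-∀

  _∈ᴵ_ : ℤ → Interval → Set
  z ∈ᴵ (lo , hi) = ⟦ lo ⟧ ℤ.≤ z × z ℤ.≤ ⟦ hi ⟧

  ∑-∈ᴵ : ∀ {zs Is} → Pointwise _∈ᴵ_ zs Is → ∑ℤ zs ∈ᴵ ∑ᴵ Is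
  ∑-∈ᴵ [] = ℤ.≤-refl , ℤ.≤-refl
  ∑-∈ᴵ {Is = (lo , hi) ∷ Is} ((l , h) ∷ rs) with ∑-∈ᴵ rs
  ... | l′ , h′ = subst (ℤ._≤ _) (sym (⟦⟧-+ lo (proj₁ (∑ᴵ Is)))) (ℤ.+-mono-≤ l l′)
                , subst (_ ℤ.≤_) (sym (⟦⟧-+ hi (proj₂ (∑ᴵ Is)))) (ℤ.+-mono-≤ h h′)

module _ {n : ℕ} (7≤n : 7 ≤ n) where

  ≤ᴸ-sound : ∀ {f g} → f ≤ᴸ g → ⟦ n ⟧ f ℤ.≤ ⟦ n ⟧ g
  ≤ᴸ-sound {a ⊹ b ·n} {c ⊹ d ·n} (le₇ , b≤d) =
    -- With n = 7 + (n ∸ 7), each side is its value at 7 plus its slope times a nonnegative number.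
    subst₂ ℤ._≤_ (split a b) (split c d) (ℤ.+-mono-≤ le₇ (ℤ.*-monoʳ-≤-nonNeg (+ (n ∸ 7)) b≤d))
    where
    open ≡-Reasoning
    split : ∀ a b → a ℤ.+ + 7 ℤ.* b ℤ.+ b ℤ.* + (n ∸ 7) ≡ a ℤ.+ b ℤ.* + n
    split a b = begin
      a ℤ.+ + 7 ℤ.* b ℤ.+ b ℤ.* + (n ∸ 7)   ≡⟨ regroup a b (+ 7) (+ (n ∸ 7)) ⟩
      a ℤ.+ b ℤ.* (+ 7 ℤ.+ + (n ∸ 7))       ≡⟨ cong (λ k → a ℤ.+ b ℤ.* + k) (ℕ.m+[n∸m]≡n 7≤n) ⟩
      a ℤ.+ b ℤ.* + n ∎
      where
      regroup : ∀ a b w k → a ℤ.+ w ℤ.* b ℤ.+ b ℤ.* k ≡ a ℤ.+ b ℤ.* (w ℤ.+ k)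
      regroup = ℤ-solve-∀

module _ {n v : ℕ} .{{_ : NonZero v}} (7≤n : 7 ≤ n) (v≡ : v ≡ modulus n 7 7) where

  +v : + v ≡ + 14 ℤ.* + n ℤ.+ + 7
  +v = trans (cong +_ v≡) (trans (cong (λ k → + (k + 7)) (twice n))
    (trans (ℤ.pos-+ (14 * n) 7) (cong (ℤ._+ + 7) (ℤ.pos-* 14 n))))
    where
    twice : ∀ n → 2 * n * 7 ≡ 14 * n
    twice = ℕ-solve-∀

  -- The affine bounds in `AvoidsMultiples` are q v + 1 and (q + 1) v - 1, so weak inequalities
  -- between them express strict position between two multiples of v.
  avoidsMultiples-sound : ∀ {z I} → AvoidsMultiples I → _∈ᴵ_ n z I → ∀ p → z ≢ p ℤ.* + v
  avoidsMultiples-sound {z} {lo , hi} avoids (l , h) with Any.satisfied avoids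
  ... | q , lo-bound , hi-bound = between-multiples q
    (ℤ.<-≤-trans (ℤ.suc[i]≤j⇒i<j (ℤ.≤-reflexive (sym below)))
      (ℤ.≤-trans (≤ᴸ-sound 7≤n {(ℤ.1ℤ ℤ.+ q ℤ.* + 7) ⊹ (q ℤ.* + 14) ·n} {lo} lo-bound) l))
    (ℤ.suc[i]≤j⇒i<j (ℤ.≤-trans (ℤ.+-monoʳ-≤ ℤ.1ℤ (ℤ.≤-trans h
      (≤ᴸ-sound 7≤n {hi} {(q ℤ.* + 7 ℤ.+ + 6) ⊹ (q ℤ.* + 14 ℤ.+ + 14) ·n} hi-bound)))
      (ℤ.≤-reflexive above)))
    where
    open ≡-Reasoning
    below : (ℤ.1ℤ ℤ.+ q ℤ.* + 7) ℤ.+ q ℤ.* + 14 ℤ.* + n ≡ ℤ.suc (q ℤ.* + v)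
    below = begin
      (ℤ.1ℤ ℤ.+ q ℤ.* + 7) ℤ.+ q ℤ.* + 14 ℤ.* + n ≡⟨ regroup ℤ.1ℤ q (+ 7) (+ 14) (+ n) ⟩
      ℤ.1ℤ ℤ.+ q ℤ.* (+ 14 ℤ.* + n ℤ.+ + 7)      ≡⟨ cong (λ w → ℤ.1ℤ ℤ.+ q ℤ.* w) +v ⟨
      ℤ.1ℤ ℤ.+ q ℤ.* + v ∎
      where
      regroup : ∀ o q s f n → (o ℤ.+ q ℤ.* s) ℤ.+ q ℤ.* f ℤ.* n ≡ o ℤ.+ q ℤ.* (f ℤ.* n ℤ.+ s)
      regroup = ℤ-solve-∀
    above : ℤ.1ℤ ℤ.+ (q ℤ.* + 7 ℤ.+ + 6 ℤ.+ (q ℤ.* + 14 ℤ.+ + 14) ℤ.* + n) ≡ ℤ.suc q ℤ.* + v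
    above = begin
      ℤ.1ℤ ℤ.+ (q ℤ.* + 7 ℤ.+ + 6 ℤ.+ (q ℤ.* + 14 ℤ.+ + 14) ℤ.* + n) ≡⟨ regroup q (+ n) ⟩
      (ℤ.1ℤ ℤ.+ q) ℤ.* (+ 14 ℤ.* + n ℤ.+ + 7)   ≡⟨ cong (ℤ.suc q ℤ.*_) +v ⟨
      ℤ.suc q ℤ.* + v ∎
      where
      regroup : ∀ q n → ℤ.1ℤ ℤ.+ (q ℤ.* + 7 ℤ.+ + 6 ℤ.+ (q ℤ.* + 14 ℤ.+ + 14) ℤ.* n)
                      ≡ (ℤ.1ℤ ℤ.+ q) ℤ.* (+ 14 ℤ.* n ℤ.+ + 7)
      regroup = ℤ-solve-∀

  -- If two partial sums agree modulo v, the segment between them sums to some q v, and its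
  -- complement to - q v because the whole line sums to 0; the certificate excludes one of the two.
  -- Partial sums start at s₁, so `head` is never empty and the full line, whose sum is 0, never
  -- occurs as the segment.
  simple : ∀ {zs Is} → Pointwise (_∈ᴵ_ n) zs Is → SegmentsAvoidMultiples Is → ∑ℤ zs ≡ ℤ.0ℤ →
    Simple (List.map (residue {v}) zs)
  simple {zs} {Is} zs∈Is avoid ∑zs≡0 (suc i) j _ i<j j≤len eq with ℕ.m≤n⇒∃[o]m+o≡n i<j
  ... | l , refl = impossible (avoid i<len l<len)
    where
    head   = take (suc i) zs
    middle = take (suc l) (drop (suc i) zs)
    tail   = drop (suc l) (drop (suc i) zs)

    len≡ : length (List.map (residue {v}) zs) ≡ length Is
    len≡ = trans (List.length-map residue zs) (Pointwise.Pointwise-length zs∈Is)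
    bound : suc (suc i) + l ≤ length Is
    bound = subst (suc (suc i) + l ≤_) len≡ j≤len
    i<len : i < length Is ∸ 1
    i<len = ℕ.∸-monoˡ-≤ 1 (ℕ.≤-trans (ℕ.m≤m+n (suc (suc i)) l) bound)
    l<len : l < length Is ∸ suc i
    l<len = ℕ.m+n≤o⇒m≤o∸n (suc l) (subst (_≤ length Is) (ℕ.+-comm (suc i) (suc l))
      (subst (_≤ length Is) (cong suc (sym (ℕ.+-suc i l))) bound))

    partial-sum : ∀ k → ∑ (take k (List.map (residue {v}) zs)) ≡ residue (∑ℤ (take k zs))
    partial-sum k = trans (cong ∑ (List.take-map k zs)) (∑-residue (take k zs))

    open ≡-Reasoning

    difference : ∃ λ q → ∑ℤ (take (suc (suc i) + l) zs) ℤ.- ∑ℤ head ≡ q ℤ.* + v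
    difference = residue-≡⇒ (∑ℤ (take (suc (suc i) + l) zs)) (∑ℤ head)
      (trans (sym (partial-sum (suc (suc i) + l))) (trans (sym eq) (partial-sum (suc i))))

    q : ℤ
    q = proj₁ difference

    cancel : ∀ a b → b ≡ a ℤ.+ b ℤ.- a
    cancel = ℤ-solve-∀

    middle-multiple : ∑ℤ middle ≡ q ℤ.* + v
    middle-multiple = begin
      ∑ℤ middle                                        ≡⟨ cancel (∑ℤ head) (∑ℤ middle) ⟩
      ∑ℤ head ℤ.+ ∑ℤ middle ℤ.- ∑ℤ head                ≡⟨ cong (ℤ._- ∑ℤ head) (∑ℤ-++ head middle) ⟨
      ∑ℤ (head ++ middle) ℤ.- ∑ℤ head                  ≡⟨ cong (λ xs → ∑ℤ xs ℤ.- ∑ℤ head) (take-+ (suc i) (suc l) zs) ⟨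
      ∑ℤ (take (suc i + suc l) zs) ℤ.- ∑ℤ head         ≡⟨ cong (λ k → ∑ℤ (take (suc k) zs) ℤ.- ∑ℤ head) (ℕ.+-suc i l) ⟩
      ∑ℤ (take (suc (suc i) + l) zs) ℤ.- ∑ℤ head       ≡⟨ proj₂ difference ⟩
      q ℤ.* + v ∎

    total : ∑ℤ head ℤ.+ (∑ℤ middle ℤ.+ ∑ℤ tail) ≡ ℤ.0ℤ
    total = begin
      ∑ℤ head ℤ.+ (∑ℤ middle ℤ.+ ∑ℤ tail)  ≡⟨ cong (ℤ._+_ (∑ℤ head)) (∑ℤ-++ middle tail) ⟨
      ∑ℤ head ℤ.+ ∑ℤ (middle ++ tail)      ≡⟨ cong (λ xs → ∑ℤ head ℤ.+ ∑ℤ xs) (List.take++drop≡id (suc l) (drop (suc i) zs)) ⟩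
      ∑ℤ head ℤ.+ ∑ℤ (drop (suc i) zs)     ≡⟨ ∑ℤ-++ head (drop (suc i) zs) ⟨
      ∑ℤ (head ++ drop (suc i) zs)         ≡⟨ cong ∑ℤ (List.take++drop≡id (suc i) zs) ⟩
      ∑ℤ zs                                ≡⟨ ∑zs≡0 ⟩
      ℤ.0ℤ ∎

    rest-multiple : ∑ℤ (head ++ tail) ≡ (ℤ.- q) ℤ.* + v
    rest-multiple = begin
      ∑ℤ (head ++ tail)                            ≡⟨ ∑ℤ-++ head tail ⟩
      ∑ℤ head ℤ.+ ∑ℤ tail                          ≡⟨ complement (∑ℤ head) (∑ℤ middle) (∑ℤ tail) ⟩
      ∑ℤ head ℤ.+ (∑ℤ middle ℤ.+ ∑ℤ tail) ℤ.- ∑ℤ middle ≡⟨ cong₂ ℤ._-_ total middle-multiple ⟩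
      ℤ.0ℤ ℤ.- q ℤ.* + v                           ≡⟨ ℤ.+-identityˡ _ ⟩
      ℤ.- (q ℤ.* + v)                              ≡⟨ ℤ.neg-distribˡ-* q (+ v) ⟩
      (ℤ.- q) ℤ.* + v ∎
      where
      complement : ∀ a b c → a ℤ.+ c ≡ a ℤ.+ (b ℤ.+ c) ℤ.- b
      complement = ℤ-solve-∀

    zs-from-i∈ : Pointwise (_∈ᴵ_ n) (drop (suc i) zs) (drop (suc i) Is)
    zs-from-i∈ = Pointwise-drop (suc i) zs∈Is

    impossible : ¬ (AvoidsMultiples (∑ᴵ (take (suc l) (drop (suc i) Is))) ⊎
                    AvoidsMultiples (∑ᴵ (take (suc i) Is ++ drop (suc l) (drop (suc i) Is))))
    impossible (inj₁ a) =
      avoidsMultiples-sound a (∑-∈ᴵ n (Pointwise-take (suc l) zs-from-i∈)) q middle-multiple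
    impossible (inj₂ a) =
      avoidsMultiples-sound a
        (∑-∈ᴵ n (Pointwise.++⁺ (Pointwise-take (suc i) zs∈Is) (Pointwise-drop (suc l) zs-from-i∈)))
        (ℤ.- q) rest-multiple

-- Interval certificates for the seven diagonals

interval₀ interval₁ interval₂ interval₄ interval₅ interval₆ positiveCentre negativeCentre : Interval
interval₀ = ℤ.- + 1 ⊹ ℤ.- + 4 ·n , ℤ.- + 2 ⊹ ℤ.- + 3 ·n
interval₁ = + 1 ⊹ + 1 ·n , + 1 ⊹ + 3 ·n
interval₂ = + 3 ⊹ + 4 ·n , + 2 ⊹ + 5 ·n
interval₄ = + 3 ⊹ + 5 ·n , + 2 ⊹ + 6 ·n
interval₅ = ℤ.- + 1 ⊹ ℤ.- + 3 ·n , ℤ.- + 1 ⊹ ℤ.- + 1 ·n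
interval₆ = ℤ.- + 3 ⊹ ℤ.- + 7 ·n , ℤ.- + 4 ⊹ ℤ.- + 6 ·n
positiveCentre = + 1 ⊹ + 0 ·n , + 0 ⊹ + 1 ·n
negativeCentre = + 0 ⊹ ℤ.- + 1 ·n , ℤ.- + 1 ⊹ + 0 ·n

lineIntervals : Interval → List Interval
lineIntervals centre = interval₀ ∷ interval₁ ∷ interval₂ ∷ centre ∷ interval₄ ∷ interval₅ ∷ interval₆ ∷ []

-- 7n + 3 is ⌊v / 2⌋ for v = 14n + 7, the bound up to which `toℤ` inverts `residue`.
BoundedByHalf : Interval → Set
BoundedByHalf (lo , hi) = ℤ.- + 3 ⊹ ℤ.- + 7 ·n ≤ᴸ lo × hi ≤ᴸ + 3 ⊹ + 7 ·n

IsLineCertificate : List Interval → Set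
IsLineCertificate Is = CyclicSegmentsAvoidMultiples Is × All BoundedByHalf Is

isLineCertificate? : ∀ Is → Dec (IsLineCertificate Is)
isLineCertificate? Is = cyclicSegmentsAvoidMultiples? Is ×-dec all? (λ _ → (_ ≤ᴸ? _) ×-dec (_ ≤ᴸ? _)) Is

-- A closed statement about finitely many integer coefficients, proved by evaluating the decision
-- procedure; `≤ᴸ-sound` turns it into a statement about every n ≥ 7. The three certificates below
-- are obtained in the same way.
column⁺ : IsLineCertificate (lineIntervals positiveCentre)
column⁺ = from-yes (isLineCertificate? (lineIntervals positiveCentre))

column⁻ : IsLineCertificate (lineIntervals negativeCentre)
column⁻ = from-yes (isLineCertificate? (lineIntervals negativeCentre))

row⁺ : IsLineCertificate (List.reverse (lineIntervals positiveCentre))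
row⁺ = from-yes (isLineCertificate? (List.reverse (lineIntervals positiveCentre)))

row⁻ : IsLineCertificate (List.reverse (lineIntervals negativeCentre))
row⁻ = from-yes (isLineCertificate? (List.reverse (lineIntervals negativeCentre)))

-- Lines of a cyclic band

module _ {a} {A : Set a} where

  tabulate-toℕ : ∀ (f : ℕ → A) n → tabulate {n = n} (f ∘ toℕ) ≡ applyUpTo f n
  tabulate-toℕ f zero    = refl
  tabulate-toℕ f (suc n) = cong (f 0 ∷_) (tabulate-toℕ (f ∘ suc) n)

  applyUpTo-cong : ∀ {f g : ℕ → A} n → (∀ {i} → i < n → f i ≡ g i) → applyUpTo f n ≡ applyUpTo g n
  applyUpTo-cong zero    _   = refl
  applyUpTo-cong (suc n) f≗g = cong₂ _∷_ (f≗g z<s) (applyUpTo-cong n (f≗g ∘ s<s))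

  applyUpTo-+ : ∀ (f : ℕ → A) m n → applyUpTo f (m + n) ≡ applyUpTo f m ++ applyUpTo (f ∘ (_+_ m)) n
  applyUpTo-+ f zero    n = refl
  applyUpTo-+ f (suc m) n = cong (f 0 ∷_) (applyUpTo-+ (f ∘ suc) m n)

  rotate-++ : ∀ (ys zs : List A) → rotate (length ys) (ys ++ zs) ≡ zs ++ ys
  rotate-++ ys zs = cong₂ _++_ (drop-++ ys) (take-++ ys)
    where
    drop-++ : ∀ ys → drop (length ys) (ys ++ zs) ≡ zs
    drop-++ []       = refl
    drop-++ (_ ∷ ys) = drop-++ ys
    take-++ : ∀ ys → take (length ys) (ys ++ zs) ≡ ys
    take-++ []       = refl
    take-++ (y ∷ ys) = cong (y ∷_) (take-++ ys)

module _ {a} {A : Set a} where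

  catMaybes-applyUpTo-just : ∀ {f : ℕ → Maybe A} {e} n → (∀ {i} → i < n → f i ≡ just (e i)) →
    catMaybes (applyUpTo f n) ≡ applyUpTo e n
  catMaybes-applyUpTo-just         zero    _ = refl
  catMaybes-applyUpTo-just {f} {e} (suc n) p rewrite p z<s = cong (e 0 ∷_) (catMaybes-applyUpTo-just n (p ∘ s<s))

  catMaybes-applyUpTo-nothing : ∀ {f : ℕ → Maybe A} n → (∀ i → f i ≡ nothing) →
    catMaybes (applyUpTo f n) ≡ []
  catMaybes-applyUpTo-nothing     zero    _ = refl
  catMaybes-applyUpTo-nothing {f} (suc n) p rewrite p 0 = catMaybes-applyUpTo-nothing n (p ∘ suc)

  band : ℕ → (ℕ → A) → ℕ → Maybe A
  band k e s = if s <ᵇ k then just (e s) else nothing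

  band-< : ∀ {k} e {s} → s < k → band k e s ≡ just (e s)
  band-< {k} e {s} s<k with s <ᵇ k in eq
  ... | true  = refl
  ... | false = contradiction (subst T eq (ℕ.<⇒<ᵇ s<k)) λ ()

  band-≥ : ∀ {k} e {s} → k ≤ s → band k e s ≡ nothing
  band-≥ {k} e {s} k≤s with s <ᵇ k in eq
  ... | true  = contradiction (ℕ.<ᵇ⇒< s k (subst T (sym eq) _)) (ℕ.≤⇒≯ k≤s)
  ... | false = refl

  catMaybes-band : ∀ {k n} e → k ≤ n → catMaybes (applyUpTo (band k e) n) ≡ applyUpTo e k
  catMaybes-band {k} e k≤n with ℕ.m≤n⇒∃[o]m+o≡n k≤n
  ... | l , refl = begin
    catMaybes (applyUpTo (band k e) (k + l))
      ≡⟨ cong catMaybes (applyUpTo-+ (band k e) k l) ⟩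
    catMaybes (applyUpTo (band k e) k ++ applyUpTo (band k e ∘ (_+_ k)) l)
      ≡⟨ List.catMaybes-++ (applyUpTo (band k e) k) _ ⟩
    catMaybes (applyUpTo (band k e) k) ++ catMaybes (applyUpTo (band k e ∘ (_+_ k)) l)
      ≡⟨ cong₂ _++_ (catMaybes-applyUpTo-just k (band-< e))
                    (catMaybes-applyUpTo-nothing l λ i → band-≥ e (ℕ.m≤m+n k i)) ⟩
    applyUpTo e k ++ []
      ≡⟨ List.++-identityʳ _ ⟩
    applyUpTo e k ∎
    where open ≡-Reasoning

  -- The line meets the indices o, ..., n - 1 and then 0, ..., o - 1. Its filled cells are thus the
  -- band rotated by the number of filled cells with index below o; this number is o while o < k,
  -- and k from then on.
  catMaybes-shifted-band : ∀ {k n o} .{{_ : NonZero n}} e → k ≤ n → o ≤ n →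
    ∃ λ j → j < suc k ×
      catMaybes (tabulate {n = n} λ i → band k e ((toℕ i + o) % n)) ≡ rotate j (applyUpTo e k)
  catMaybes-shifted-band {k} {n} {o} e k≤n o≤n with ℕ.m≤n⇒∃[o]m+o≡n o≤n
  ... | l , refl = length ys , s≤s length≤k , (begin
    catMaybes (tabulate {n = o + l} (h′ ∘ toℕ))
      ≡⟨ cong catMaybes (tabulate-toℕ h′ (o + l)) ⟩
    catMaybes (applyUpTo h′ (o + l))
      ≡⟨ cong (catMaybes ∘ applyUpTo h′) (ℕ.+-comm o l) ⟩
    catMaybes (applyUpTo h′ (l + o))
      ≡⟨ cong catMaybes (applyUpTo-+ h′ l o) ⟩
    catMaybes (applyUpTo h′ l ++ applyUpTo (h′ ∘ (_+_ l)) o)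
      ≡⟨ cong₂ (λ xs ys → catMaybes (xs ++ ys)) (applyUpTo-cong l before-wrap) (applyUpTo-cong o after-wrap) ⟩
    catMaybes (applyUpTo (h ∘ (_+_ o)) l ++ applyUpTo h o)
      ≡⟨ List.catMaybes-++ (applyUpTo (h ∘ (_+_ o)) l) _ ⟩
    zs ++ ys
      ≡⟨ rotate-++ ys zs ⟨
    rotate (length ys) (ys ++ zs)
      ≡⟨ cong (rotate (length ys)) ys++zs ⟩
    rotate (length ys) (applyUpTo e k) ∎)
    where
    open ≡-Reasoning
    h h′ : ℕ → Maybe A
    h = band k e
    h′ i = h ((i + o) % (o + l))
    ys zs : List A
    ys = catMaybes (applyUpTo h o)
    zs = catMaybes (applyUpTo (h ∘ (_+_ o)) l)
    before-wrap : ∀ {i} → i < l → h′ i ≡ h (o + i)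
    before-wrap {i} i<l = cong h (trans (m<n⇒m%n≡m (subst (i + o <_) (ℕ.+-comm l o) (ℕ.+-monoˡ-< o i<l))) (ℕ.+-comm i o))
    after-wrap : ∀ {i} → i < o → h′ (l + i) ≡ h i
    after-wrap {i} i<o = cong h (begin
      (l + i + o) % (o + l)    ≡⟨ %-congˡ (trans (cong (_+ o) (ℕ.+-comm l i)) (trans (ℕ.+-assoc i l o) (cong (_+_ i) (ℕ.+-comm l o)))) ⟩
      (i + (o + l)) % (o + l)  ≡⟨ [m+n]%n≡m%n i (o + l) ⟩
      i % (o + l)              ≡⟨ m<n⇒m%n≡m (ℕ.<-≤-trans i<o o≤n) ⟩
      i ∎)
    ys++zs : ys ++ zs ≡ applyUpTo e k
    ys++zs = begin
      ys ++ zs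
        ≡⟨ List.catMaybes-++ (applyUpTo h o) _ ⟨
      catMaybes (applyUpTo h o ++ applyUpTo (h ∘ (_+_ o)) l)
        ≡⟨ cong catMaybes (applyUpTo-+ h o l) ⟨
      catMaybes (applyUpTo h (o + l))
        ≡⟨ catMaybes-band e k≤n ⟩
      applyUpTo e k ∎
    length≤k : length ys ≤ k
    length≤k = subst (length ys ≤_)
      (trans (sym (List.length-++ ys)) (trans (cong length ys++zs) (List.length-applyUpTo e k)))
      (ℕ.m≤m+n (length ys) (length zs))

-- The zigzag sequence

≤-from-complement : ∀ {x y} d → x + d ≡ y → x ≤ y
≤-from-complement d refl = ℕ.m≤m+n _ d

-- The difference is returned as a witness: matching on its equation replaces the larger number by a
-- sum, and what remains are polynomial identities free of truncated subtraction.
≤⊎> : ∀ x y → (∃ λ d → y + d ≡ x) ⊎ (∃ λ d → suc x + d ≡ y)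
≤⊎> x y with ℕ.≤-<-connex y x
... | inj₁ le = inj₁ (ℕ.m≤n⇒∃[o]m+o≡n le)
... | inj₂ lt = inj₂ (ℕ.m≤n⇒∃[o]m+o≡n lt)

halve : ∀ k → ∃ λ j → (k ≡ 2 * j) ⊎ (k ≡ suc (2 * j))
halve zero = 0 , inj₁ refl
halve (suc k) with halve k
... | j , inj₁ k≡2j   = j , inj₂ (cong suc k≡2j)
... | j , inj₂ k≡1+2j = suc j , inj₁ (trans (cong suc k≡1+2j) (cong suc (sym (ℕ.+-suc j (j + 0)))))

module _ (ε : ℤ) where

  -- Two interleaved progressions a, a + ε, ... and b, b + ε, ... . Passing from one pair of
  -- neighbours to the next replaces a summand x by x + ε, so the sums of neighbours form a
  -- progression with step ε as well.
  zigzag : ℤ → ℤ → ℕ → ℤ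
  zigzag a b zero    = a
  zigzag a b (suc k) = zigzag b (a ℤ.+ ε) k

  private
    shift : ∀ a k → (a ℤ.+ ε) ℤ.+ + k ℤ.* ε ≡ a ℤ.+ + suc k ℤ.* ε
    shift a k = trans (ℤ.+-assoc a ε (+ k ℤ.* ε)) (cong (λ z → a ℤ.+ z) (sym (ℤ.suc-* (+ k) ε)))

  zigzag-even : ∀ a b j → zigzag a b (2 * j) ≡ a ℤ.+ + j ℤ.* ε
  zigzag-even a b zero = sym (trans (cong (λ z → a ℤ.+ z) (ℤ.*-zeroˡ ε)) (ℤ.+-identityʳ a))
  zigzag-even a b (suc j) rewrite ℕ.+-suc j (j + 0) =
    trans (zigzag-even (a ℤ.+ ε) (b ℤ.+ ε) j) (shift a j)

  zigzag-odd : ∀ a b j → zigzag a b (suc (2 * j)) ≡ b ℤ.+ + j ℤ.* ε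
  zigzag-odd a b = zigzag-even b (a ℤ.+ ε)

  zigzag-sum : ∀ a b k → zigzag a b k ℤ.+ zigzag a b (suc k) ≡ (a ℤ.+ b) ℤ.+ + k ℤ.* ε
  zigzag-sum a b zero = sym (trans (cong (λ z → (a ℤ.+ b) ℤ.+ z) (ℤ.*-zeroˡ ε)) (ℤ.+-identityʳ (a ℤ.+ b)))
  zigzag-sum a b (suc k) = trans (zigzag-sum b (a ℤ.+ ε) k)
    (trans (cong (λ z → z ℤ.+ + k ℤ.* ε) (regroup a b ε)) (shift (a ℤ.+ b) k))
    where
    regroup : ∀ a b c → b ℤ.+ (a ℤ.+ c) ≡ (a ℤ.+ b) ℤ.+ c
    regroup = ℤ-solve-∀

module _ (m : ℕ) where

  -- The first 2m + 2 terms have the absolute values m + 1, ..., 1 interleaved with 3m + 3, ..., 4m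
  -- + 3; the other 2m + 1 terms have 2m + 2, ..., 3m + 2 interleaved with 2m + 1, ..., m + 2. For m
  -- = 1 the sequence is 2, -6, 1, -7, 4, -3, 5, and its cyclic sums of neighbours are -4, -5, -6,
  -- -3, 1, 2, 7.
  descending ascending heffter : ℕ → ℤ
  descending = zigzag ℤ.-1ℤ (+ (1 + m)) (ℤ.- + (3 + 3 * m))
  ascending  = zigzag ℤ.1ℤ (+ (2 + 2 * m)) (ℤ.- + (1 + 2 * m))
  heffter k  = if k <ᵇ 2 + 2 * m then descending k else ascending (k ∸ (2 + 2 * m))

  heffter-descending : ∀ {k} → k < 2 + 2 * m → heffter k ≡ descending k
  heffter-descending {k} k< with k <ᵇ 2 + 2 * m in eq
  ... | true  = refl
  ... | false = contradiction (subst T eq (ℕ.<⇒<ᵇ k<)) λ ()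

  heffter-ascending : ∀ k → heffter (2 + 2 * m + k) ≡ ascending k
  heffter-ascending k with 2 + 2 * m + k <ᵇ 2 + 2 * m in eq
  ... | true  = contradiction (ℕ.<ᵇ⇒< (2 + 2 * m + k) (2 + 2 * m) (subst T (sym eq) _)) (ℕ.m+n≮m (2 + 2 * m) k)
  ... | false = cong ascending (ℕ.m+n∸m≡n (2 + 2 * m) k)

private
  +i : ∀ i j → + (1 + (i + j)) ℤ.+ + j ℤ.* ℤ.-1ℤ ≡ + (1 + i)
  +i i j = begin
    + (1 + i + j) ℤ.+ + j ℤ.* ℤ.-1ℤ       ≡⟨ cong (λ z → z ℤ.+ + j ℤ.* ℤ.-1ℤ) (ℤ.pos-+ (1 + i) j) ⟩
    + (1 + i) ℤ.+ + j ℤ.+ + j ℤ.* ℤ.-1ℤ   ≡⟨ cancel (+ (1 + i)) (+ j) ⟩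
    + (1 + i) ∎
    where
    open ≡-Reasoning
    cancel : ∀ a b → a ℤ.+ b ℤ.+ b ℤ.* ℤ.-1ℤ ≡ a
    cancel = ℤ-solve-∀

  -a-j : ∀ a j → ℤ.- + a ℤ.+ + j ℤ.* ℤ.-1ℤ ≡ ℤ.- + (a + j)
  -a-j a j = trans (regroup (+ a) (+ j)) (cong ℤ.-_ (sym (ℤ.pos-+ a j)))
    where
    regroup : ∀ a b → ℤ.- a ℤ.+ b ℤ.* ℤ.-1ℤ ≡ ℤ.- (a ℤ.+ b)
    regroup = ℤ-solve-∀

  a+j : ∀ a j → + a ℤ.+ + j ℤ.* ℤ.1ℤ ≡ + (a + j)
  a+j a j = trans (cong (λ z → + a ℤ.+ z) (ℤ.*-identityʳ (+ j))) (sym (ℤ.pos-+ a j))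

  -a+j : ∀ a j → ℤ.- + (a + j) ℤ.+ + j ℤ.* ℤ.1ℤ ≡ ℤ.- + a
  -a+j a j = trans (cong (λ z → ℤ.- z ℤ.+ + j ℤ.* ℤ.1ℤ) (ℤ.pos-+ a j)) (cancel (+ a) (+ j))
    where
    cancel : ∀ a b → ℤ.- (a ℤ.+ b) ℤ.+ b ℤ.* ℤ.1ℤ ≡ ℤ.- a
    cancel = ℤ-solve-∀

  a-b : ∀ a b → + a ℤ.- + (a + b) ≡ ℤ.- + b
  a-b a b = trans (cong (λ z → + a ℤ.- z) (ℤ.pos-+ a b)) (cancel (+ a) (+ b))
    where
    cancel : ∀ a b → a ℤ.- (a ℤ.+ b) ≡ ℤ.- b
    cancel = ℤ-solve-∀

heffter-even-descending : ∀ i j → heffter (i + j) (2 * j) ≡ + (1 + i)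
heffter-even-descending i j = trans
  (heffter-descending (i + j) (≤-from-complement (1 + 2 * i) (arith i j)))
  (trans (zigzag-even ℤ.-1ℤ _ _ j) (+i i j))
  where
  arith : ∀ i j → suc (2 * j) + (1 + 2 * i) ≡ 2 + 2 * (i + j)
  arith = ℕ-solve-∀

heffter-odd-descending : ∀ i j → heffter (i + j) (1 + 2 * j) ≡ ℤ.- + (3 + 3 * (i + j) + j)
heffter-odd-descending i j = trans
  (heffter-descending (i + j) {1 + 2 * j} (≤-from-complement (2 * i) (arith i j)))
  (trans (zigzag-odd ℤ.-1ℤ (+ (1 + (i + j))) (ℤ.- + (3 + 3 * (i + j))) j) (-a-j (3 + 3 * (i + j)) j))
  where
  arith : ∀ i j → suc (1 + 2 * j) + 2 * i ≡ 2 + 2 * (i + j)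
  arith = ℕ-solve-∀

heffter-even-ascending : ∀ m j → heffter m (2 + 2 * m + 2 * j) ≡ + (2 + 2 * m + j)
heffter-even-ascending m j = trans (heffter-ascending m (2 * j))
  (trans (zigzag-even ℤ.1ℤ _ _ j) (a+j (2 + 2 * m) j))

heffter-odd-ascending : ∀ i j → let m = 1 + (i + j) in
  heffter m (2 + 2 * m + (1 + 2 * j)) ≡ ℤ.- + (2 + m + i)
heffter-odd-ascending i j = trans (heffter-ascending m (1 + 2 * j))
  (trans (zigzag-odd ℤ.1ℤ (+ (2 + 2 * m)) (ℤ.- + (1 + 2 * m)) j)
    (trans (cong (λ a → ℤ.- + a ℤ.+ + j ℤ.* ℤ.1ℤ) (arith i j)) (-a+j (2 + m + i) j)))
  where
  m = 1 + (i + j)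
  arith : ∀ i j → 1 + 2 * (1 + (i + j)) ≡ 2 + (1 + (i + j)) + i + j
  arith = ℕ-solve-∀

heffter-sum-descending : ∀ i k {m} → i + k ≡ 2 * m → heffter m k ℤ.+ heffter m (1 + k) ≡ ℤ.- + (2 + 2 * m + k)
heffter-sum-descending i k {m} eq = begin
  heffter m k ℤ.+ heffter m (1 + k)
    ≡⟨ cong₂ ℤ._+_ (heffter-descending m (≤-from-complement (1 + i) below))
                   (heffter-descending m (≤-from-complement i below′)) ⟩
  descending m k ℤ.+ descending m (1 + k)
    ≡⟨ zigzag-sum ℤ.-1ℤ (+ (1 + m)) (ℤ.- + (3 + 3 * m)) k ⟩
  (+ (1 + m) ℤ.- + (3 + 3 * m)) ℤ.+ + k ℤ.* ℤ.-1ℤ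
    ≡⟨ cong (λ a → (+ (1 + m) ℤ.- + a) ℤ.+ + k ℤ.* ℤ.-1ℤ) (arith m) ⟩
  (+ (1 + m) ℤ.- + (1 + m + (2 + 2 * m))) ℤ.+ + k ℤ.* ℤ.-1ℤ
    ≡⟨ cong (λ z → z ℤ.+ + k ℤ.* ℤ.-1ℤ) (a-b (1 + m) (2 + 2 * m)) ⟩
  ℤ.- + (2 + 2 * m) ℤ.+ + k ℤ.* ℤ.-1ℤ
    ≡⟨ -a-j (2 + 2 * m) k ⟩
  ℤ.- + (2 + 2 * m + k) ∎
  where
  open ≡-Reasoning
  arith : ∀ m → 3 + 3 * m ≡ 1 + m + (2 + 2 * m)
  arith = ℕ-solve-∀
  regroup : ∀ i k → suc k + (1 + i) ≡ 2 + (i + k)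
  regroup = ℕ-solve-∀
  regroup′ : ∀ i k → suc (1 + k) + i ≡ 2 + (i + k)
  regroup′ = ℕ-solve-∀
  below : suc k + (1 + i) ≡ 2 + 2 * m
  below = trans (regroup i k) (cong (_+_ 2) eq)
  below′ : suc (1 + k) + i ≡ 2 + 2 * m
  below′ = trans (regroup′ i k) (cong (_+_ 2) eq)

heffter-sum-middle : ∀ m → heffter m (1 + 2 * m) ℤ.+ heffter m (2 + 2 * m) ≡ ℤ.- + (1 + 2 * m)
heffter-sum-middle m = begin
  heffter m (1 + 2 * m) ℤ.+ heffter m (2 + 2 * m)
    ≡⟨ cong₂ ℤ._+_ (heffter-odd-descending 0 m)
         (trans (cong (heffter m) (sym (ℕ.+-identityʳ (2 + 2 * m)))) (heffter-ascending m 0)) ⟩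
  ℤ.- + (3 + 3 * m + m) ℤ.+ + (2 + 2 * m)
    ≡⟨ ℤ.+-comm (ℤ.- + (3 + 3 * m + m)) (+ (2 + 2 * m)) ⟩
  + (2 + 2 * m) ℤ.- + (3 + 3 * m + m)
    ≡⟨ cong (λ a → + (2 + 2 * m) ℤ.- + a) (arith m) ⟩
  + (2 + 2 * m) ℤ.- + (2 + 2 * m + (1 + 2 * m))
    ≡⟨ a-b (2 + 2 * m) (1 + 2 * m) ⟩
  ℤ.- + (1 + 2 * m) ∎
  where
  open ≡-Reasoning
  arith : ∀ m → 3 + 3 * m + m ≡ 2 + 2 * m + (1 + 2 * m)
  arith = ℕ-solve-∀

heffter-sum-ascending : ∀ m k → heffter m (2 + 2 * m + k) ℤ.+ heffter m (1 + (2 + 2 * m + k)) ≡ + (1 + k)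
heffter-sum-ascending m k = begin
  heffter m (2 + 2 * m + k) ℤ.+ heffter m (1 + (2 + 2 * m + k))
    ≡⟨ cong₂ ℤ._+_ (heffter-ascending m k)
         (trans (cong (heffter m) (sym (ℕ.+-suc (2 + 2 * m) k))) (heffter-ascending m (suc k))) ⟩
  ascending m k ℤ.+ ascending m (suc k)
    ≡⟨ zigzag-sum ℤ.1ℤ (+ (2 + 2 * m)) (ℤ.- + (1 + 2 * m)) k ⟩
  (+ (2 + 2 * m) ℤ.- + (1 + 2 * m)) ℤ.+ + k ℤ.* ℤ.1ℤ
    ≡⟨ cong₂ ℤ._+_ (trans (cong (λ z → z ℤ.- + (1 + 2 * m)) (ℤ.pos-+ 1 (1 + 2 * m))) (cancel ℤ.1ℤ (+ (1 + 2 * m))))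
         (ℤ.*-identityʳ (+ k)) ⟩
  + (1 + k) ∎
  where
  open ≡-Reasoning
  cancel : ∀ a b → a ℤ.+ b ℤ.- b ≡ a
  cancel = ℤ-solve-∀

heffter-sum-closing : ∀ m → heffter m (2 + 4 * m) ℤ.+ heffter m 0 ≡ + (3 + 4 * m)
heffter-sum-closing m = begin
  heffter m (2 + 4 * m) ℤ.+ heffter m 0
    ≡⟨ cong (λ k → heffter m k ℤ.+ heffter m 0) (arith m) ⟩
  heffter m (2 + 2 * m + 2 * m) ℤ.+ heffter m 0
    ≡⟨ cong₂ ℤ._+_ (heffter-even-ascending m m) (heffter-descending m z<s) ⟩
  + (2 + 2 * m + m + (1 + m))
    ≡⟨ cong +_ (arith′ m) ⟩
  + (3 + 4 * m) ∎
  where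
  open ≡-Reasoning
  arith : ∀ m → 2 + 4 * m ≡ 2 + 2 * m + 2 * m
  arith = ℕ-solve-∀
  arith′ : ∀ m → 2 + 2 * m + m + (1 + m) ≡ 3 + 4 * m
  arith′ = ℕ-solve-∀


-- The four progressions inside the two zigzags. Each constructor carries the complement `i` of `j`,
-- in which the terms that decrease in absolute value become polynomials with natural coefficients.
data Position (m : ℕ) : ℕ → Set where
  even-descending : ∀ i j → i + j ≡ m → Position m (2 * j)
  odd-descending  : ∀ i j → i + j ≡ m → Position m (1 + 2 * j)
  even-ascending  : ∀ i j → i + j ≡ m → Position m (2 + 2 * m + 2 * j)
  odd-ascending   : ∀ i j → 1 + (i + j) ≡ m → Position m (2 + 2 * m + (1 + 2 * j))

2j<2+2m⇒j≤m : ∀ {j m} → 2 * j < 2 + 2 * m → ∃ λ i → i + j ≡ m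
2j<2+2m⇒j≤m {j} {m} lt
  with ℕ.m≤n⇒∃[o]m+o≡n {j} {m}
    (s≤s⁻¹ (ℕ.*-cancelˡ-< 2 j (suc m) (subst (2 * j <_) (sym (ℕ.*-suc 2 m)) lt)))
... | i , eq = i , trans (ℕ.+-comm i j) eq

position : ∀ m k → k < 3 + 4 * m → Position m k
position m k k<n with ≤⊎> (1 + 2 * m) k
position m k k<n | inj₁ (d , eq) with halve k
... | j , inj₁ refl with 2j<2+2m⇒j≤m {j} {m} (s≤s (≤-from-complement d eq))
...   | i , i+j≡m = even-descending i j i+j≡m
position m k k<n | inj₁ (d , eq) | j , inj₂ refl with 2j<2+2m⇒j≤m {j} {m} (ℕ.m≤n⇒m≤1+n (≤-from-complement d eq))
...   | i , i+j≡m = odd-descending i j i+j≡m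
position m k k<n | inj₂ (d , refl) = ascending-position d
  (ℕ.+-cancelˡ-< (2 + 2 * m) d (1 + 2 * m) (subst (2 + 2 * m + d <_) (arith m) k<n))
  where
  arith : ∀ m → 3 + 4 * m ≡ 2 + 2 * m + (1 + 2 * m)
  arith = ℕ-solve-∀
  ascending-position : ∀ d → d < 1 + 2 * m → Position m (2 + 2 * m + d)
  ascending-position d d< with halve d
  ... | j , inj₁ refl with 2j<2+2m⇒j≤m {j} {m} (ℕ.m≤n⇒m≤1+n d<)
  ...   | i , i+j≡m = even-ascending i j i+j≡m
  ascending-position d d< | j , inj₂ refl
    with ℕ.m≤n⇒∃[o]m+o≡n {suc j} {m} (ℕ.*-cancelˡ-< 2 j m (s≤s⁻¹ d<))
  ...   | i , eq = odd-ascending i j (trans (cong suc (ℕ.+-comm i j)) eq)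

∣-+∣ : ∀ {z} a → z ≡ ℤ.- + a → ∣ z ∣ ≡ a
∣-+∣ a refl = ℤ.∣-i∣≡∣i∣ (+ a)

∣+∣ : ∀ {z} a → z ≡ + a → ∣ z ∣ ≡ a
∣+∣ a refl = refl

∣heffter∣-≤ : ∀ m k → k < 3 + 4 * m → ∣ heffter m k ∣ ≤ 3 + 4 * m
∣heffter∣-≤ m k k<n with position m k k<n
... | even-descending i j refl = ℕ.≤-trans (ℕ.≤-reflexive (∣+∣ (1 + i) (heffter-even-descending i j)))
  (≤-from-complement (2 + 3 * i + 4 * j) (arith i j))
  where
  arith : ∀ i j → 1 + i + (2 + 3 * i + 4 * j) ≡ 3 + 4 * (i + j)
  arith = ℕ-solve-∀
... | odd-descending i j refl = ℕ.≤-trans (ℕ.≤-reflexive (∣-+∣ _ (heffter-odd-descending i j)))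
  (≤-from-complement i (arith i j))
  where
  arith : ∀ i j → 3 + 3 * (i + j) + j + i ≡ 3 + 4 * (i + j)
  arith = ℕ-solve-∀
... | even-ascending i j refl = ℕ.≤-trans (ℕ.≤-reflexive (∣+∣ _ (heffter-even-ascending (i + j) j)))
  (≤-from-complement (1 + 2 * i + j) (arith i j))
  where
  arith : ∀ i j → 2 + 2 * (i + j) + j + (1 + 2 * i + j) ≡ 3 + 4 * (i + j)
  arith = ℕ-solve-∀
... | odd-ascending i j refl = ℕ.≤-trans (ℕ.≤-reflexive (∣-+∣ _ (heffter-odd-ascending i j)))
  (≤-from-complement (4 + 2 * i + 3 * j) (arith i j))
  where
  arith : ∀ i j → 2 + (1 + (i + j)) + i + (4 + 2 * i + 3 * j) ≡ 3 + 4 * (1 + (i + j))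
  arith = ℕ-solve-∀

-- Cutting 1, ..., 4m + 3 after m + 1, 2m + 1 and 3m + 2 gives four runs, taken in this order by the
-- even descending, odd ascending, even ascending and odd descending terms.
∣heffter∣-onto : ∀ m b → 1 ≤ b → b ≤ 3 + 4 * m → ∃ λ k → k < 3 + 4 * m × ∣ heffter m k ∣ ≡ b
∣heffter∣-onto m (suc i) _ b≤n with ≤⊎> m i
... | inj₁ (j , refl) = 2 * j , ≤-from-complement (2 + 4 * i + 2 * j) (arith i j) , ∣+∣ _ (heffter-even-descending i j)
  where
  arith : ∀ i j → suc (2 * j) + (2 + 4 * i + 2 * j) ≡ 3 + 4 * (i + j)
  arith = ℕ-solve-∀
... | inj₂ (d , refl) with ≤⊎> m (suc d)
...   | inj₁ (j , refl) = 2 + 2 * (suc d + j) + (1 + 2 * j)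
  , ≤-from-complement (1 + (2 * d + 0)) (arith d j)
  , trans (∣-+∣ _ (heffter-odd-ascending d j)) (arith′ d j)
  where
  arith : ∀ d j → suc (2 + 2 * (suc d + j) + (1 + 2 * j)) + (1 + (2 * d + 0)) ≡ 3 + 4 * (suc d + j)
  arith = ℕ-solve-∀
  arith′ : ∀ d j → 2 + (1 + (d + j)) + d ≡ suc (suc (suc d + j) + d)
  arith′ = ℕ-solve-∀
...   | inj₂ (j , eq) with ℕ.suc-injective eq
...     | refl with ≤⊎> m j
...       | inj₁ (i , refl) = 2 + 2 * (j + i) + 2 * j
  , ≤-from-complement (2 * i) (arith i j)
  , trans (∣+∣ _ (heffter-even-ascending (j + i) j)) (arith′ i j)
  where
  arith : ∀ i j → suc (2 + 2 * (j + i) + 2 * j) + 2 * i ≡ 3 + 4 * (j + i)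
  arith = ℕ-solve-∀
  arith′ : ∀ i j → 2 + 2 * (j + i) + j ≡ suc (suc (j + i) + (j + i + j))
  arith′ = ℕ-solve-∀
...       | inj₂ (j′ , refl) with ℕ.m≤n⇒∃[o]m+o≡n b≤n
-- In the last run b = 3m + 3 + `j′`, and b ≤ 4m + 3 supplies the complement `i` with i + `j′` = m.
...         | i , eq′ with ℕ.+-cancelˡ-≡ (3 + 3 * m) (i + j′) m (trans (arith i j′ m) (trans eq′ (arith′ m)))
  where
  arith : ∀ i j m → 3 + 3 * m + (i + j) ≡ suc (suc m + (m + (suc m + j))) + i
  arith = ℕ-solve-∀
  arith′ : ∀ m → 3 + 4 * m ≡ 3 + 3 * m + m
  arith′ = ℕ-solve-∀
...           | refl = 1 + 2 * j′
  , ≤-from-complement (1 + 4 * i + 2 * j′) (arith i j′)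
  , trans (∣-+∣ _ (heffter-odd-descending i j′)) (arith′ (i + j′) j′)
  where
  arith : ∀ i j → suc (1 + 2 * j) + (1 + 4 * i + 2 * j) ≡ 3 + 4 * (i + j)
  arith = ℕ-solve-∀
  arith′ : ∀ m j → 3 + 3 * m + j ≡ suc (suc m + (m + (suc m + j)))
  arith′ = ℕ-solve-∀

-- Sums of cyclic neighbours in the zigzag sequence

heffter-sum : ℕ → ℕ → ℤ
heffter-sum m k = heffter m k ℤ.+ heffter m (suc k % (3 + 4 * m))

∣heffter-sum∣-nonclosing : ∀ m k → suc k < 3 + 4 * m → ∣ heffter-sum m k ∣ ≡ ∣ heffter m k ℤ.+ heffter m (suc k) ∣
∣heffter-sum∣-nonclosing m k lt = cong (λ r → ∣ heffter m k ℤ.+ heffter m r ∣) (m<n⇒m%n≡m lt)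

∣heffter-sum∣-descending : ∀ i k {m} → i + k ≡ 2 * m → ∣ heffter-sum m k ∣ ≡ 2 + 2 * m + k
∣heffter-sum∣-descending i k {m} eq = trans
  (∣heffter-sum∣-nonclosing m k (≤-from-complement (1 + i + 2 * m) below))
  (∣-+∣ _ (heffter-sum-descending i k eq))
  where
  arith : ∀ i k m → suc (suc k) + (1 + i + 2 * m) ≡ 3 + 2 * m + (i + k)
  arith = ℕ-solve-∀
  arith′ : ∀ m → 3 + 2 * m + 2 * m ≡ 3 + 4 * m
  arith′ = ℕ-solve-∀
  below : suc (suc k) + (1 + i + 2 * m) ≡ 3 + 4 * m
  below = trans (arith i k m) (trans (cong (λ a → 3 + 2 * m + a) eq) (arith′ m))

∣heffter-sum∣-middle : ∀ m → ∣ heffter-sum m (1 + 2 * m) ∣ ≡ 1 + 2 * m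
∣heffter-sum∣-middle m = trans
  (∣heffter-sum∣-nonclosing m (1 + 2 * m) (≤-from-complement (2 * m) (arith m)))
  (∣-+∣ _ (heffter-sum-middle m))
  where
  arith : ∀ m → suc (2 + 2 * m) + 2 * m ≡ 3 + 4 * m
  arith = ℕ-solve-∀

∣heffter-sum∣-ascending : ∀ i k {m} → i + suc k ≡ 2 * m → ∣ heffter-sum m (2 + 2 * m + k) ∣ ≡ 1 + k
∣heffter-sum∣-ascending i k {m} eq = trans
  (∣heffter-sum∣-nonclosing m (2 + 2 * m + k) (≤-from-complement i below))
  (∣+∣ _ (heffter-sum-ascending m k))
  where
  arith : ∀ i k m → suc (suc (2 + 2 * m + k)) + i ≡ 3 + 2 * m + (i + suc k)
  arith = ℕ-solve-∀
  arith′ : ∀ m → 3 + 2 * m + 2 * m ≡ 3 + 4 * m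
  arith′ = ℕ-solve-∀
  below : suc (suc (2 + 2 * m + k)) + i ≡ 3 + 4 * m
  below = trans (arith i k m) (trans (cong (λ a → 3 + 2 * m + a) eq) (arith′ m))

∣heffter-sum∣-closing : ∀ m → ∣ heffter-sum m (2 + 4 * m) ∣ ≡ 3 + 4 * m
∣heffter-sum∣-closing m = trans
  (cong (λ r → ∣ heffter m (2 + 4 * m) ℤ.+ heffter m r ∣) (n%n≡0 (3 + 4 * m)))
  (∣+∣ _ (heffter-sum-closing m))

∣heffter-sum∣-bounds : ∀ m k → k < 3 + 4 * m → 1 ≤ ∣ heffter-sum m k ∣ × ∣ heffter-sum m k ∣ ≤ 3 + 4 * m
∣heffter-sum∣-bounds m k k<n with ≤⊎> (2 * m) k
... | inj₁ (i , eq) rewrite ∣heffter-sum∣-descending i k {m} (trans (ℕ.+-comm i k) eq)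
  = s≤s z≤n , ≤-from-complement (1 + i) (trans (arith i k m) (trans (cong (λ a → 3 + 2 * m + a) eq) (arith′ m)))
  where
  arith : ∀ i k m → 2 + 2 * m + k + (1 + i) ≡ 3 + 2 * m + (k + i)
  arith = ℕ-solve-∀
  arith′ : ∀ m → 3 + 2 * m + 2 * m ≡ 3 + 4 * m
  arith′ = ℕ-solve-∀
... | inj₂ (zero , refl) rewrite ℕ.+-identityʳ (2 * m) | ∣heffter-sum∣-middle m
  = s≤s z≤n , ≤-from-complement (2 + 2 * m) (arith m)
  where
  arith : ∀ m → 1 + 2 * m + (2 + 2 * m) ≡ 3 + 4 * m
  arith = ℕ-solve-∀
... | inj₂ (suc k′ , refl) rewrite ℕ.+-suc (2 * m) k′ with ≤⊎> (2 * m) (suc k′)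
...   | inj₁ (i , eq) rewrite ∣heffter-sum∣-ascending i k′ {m} (trans (ℕ.+-comm i (suc k′)) eq)
  = s≤s z≤n , ≤-from-complement (3 + 2 * m + i)
      (trans (arith i k′ m) (trans (cong (λ a → 3 + 2 * m + a) eq) (arith′ m)))
  where
  arith : ∀ i k m → 1 + k + (3 + 2 * m + i) ≡ 3 + 2 * m + (suc k + i)
  arith = ℕ-solve-∀
  arith′ : ∀ m → 3 + 2 * m + 2 * m ≡ 3 + 4 * m
  arith′ = ℕ-solve-∀
...   | inj₂ (suc d , refl) = contradiction k<n (ℕ.≤⇒≯ (≤-from-complement d (arith d m)))
  where
  arith : ∀ d m → 3 + 4 * m + d ≡ 2 + 2 * m + (2 * m + suc d)
  arith = ℕ-solve-∀
...   | inj₂ (zero , refl) = subst (λ k → 1 ≤ ∣ heffter-sum m k ∣ × ∣ heffter-sum m k ∣ ≤ 3 + 4 * m) (arith m)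
  (subst (λ a → 1 ≤ a × a ≤ 3 + 4 * m) (sym (∣heffter-sum∣-closing m)) (s≤s z≤n , ℕ.≤-refl))
  where
  arith : ∀ m → 2 + 4 * m ≡ 2 + 2 * m + (2 * m + 0)
  arith = ℕ-solve-∀

-- The ascending zigzag gives 1, ..., 2m and the descending one 2m + 2, ..., 4m + 2. The two missing
-- values come from the joints: 2m + 1 where the zigzags meet, and 4m + 3 where the cycle closes.
∣heffter-sum∣-onto : ∀ m b → 1 ≤ b → b ≤ 3 + 4 * m → ∃ λ k → k < 3 + 4 * m × ∣ heffter-sum m k ∣ ≡ b
∣heffter-sum∣-onto m (suc k) _ b≤n with ≤⊎> (2 * m) (suc k)
... | inj₁ (i , eq) = 2 + 2 * m + k
  , ≤-from-complement (1 + i) (trans (arith i k m) (trans (cong (λ a → 3 + 2 * m + a) eq) (arith′ m)))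
  , ∣heffter-sum∣-ascending i k {m} (trans (ℕ.+-comm i (suc k)) eq)
  where
  arith : ∀ i k m → suc (2 + 2 * m + k) + (1 + i) ≡ 3 + 2 * m + (suc k + i)
  arith = ℕ-solve-∀
  arith′ : ∀ m → 3 + 2 * m + 2 * m ≡ 3 + 4 * m
  arith′ = ℕ-solve-∀
... | inj₂ (zero , refl) = 1 + 2 * m , ≤-from-complement (1 + 2 * m) (arith m)
  , trans (∣heffter-sum∣-middle m) (cong suc (sym (ℕ.+-identityʳ (2 * m))))
  where
  arith : ∀ m → suc (1 + 2 * m) + (1 + 2 * m) ≡ 3 + 4 * m
  arith = ℕ-solve-∀
... | inj₂ (suc d , refl) with ≤⊎> (2 * m) d
...   | inj₁ (i , eq) = d
  , ≤-from-complement (2 + 2 * m + i) (trans (arith d i m) (trans (cong (λ a → 3 + 2 * m + a) eq) (arith′ m)))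
  , trans (∣heffter-sum∣-descending i d {m} (trans (ℕ.+-comm i d) eq)) (cong suc (sym (ℕ.+-suc (2 * m) d)))
  where
  arith : ∀ d i m → suc d + (2 + 2 * m + i) ≡ 3 + 2 * m + (d + i)
  arith = ℕ-solve-∀
  arith′ : ∀ m → 3 + 2 * m + 2 * m ≡ 3 + 4 * m
  arith′ = ℕ-solve-∀
...   | inj₂ (zero , refl) = 2 + 4 * m , ℕ.≤-refl , trans (∣heffter-sum∣-closing m) (arith m)
  where
  arith : ∀ m → 3 + 4 * m ≡ suc (2 * m + suc (suc (2 * m + 0)))
  arith = ℕ-solve-∀
...   | inj₂ (suc e , refl) = contradiction b≤n (ℕ.<⇒≱ (≤-from-complement e (arith e m)))
  where
  arith : ∀ e m → suc (3 + 4 * m) + e ≡ suc (2 * m + suc (suc (2 * m + suc e)))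
  arith = ℕ-solve-∀

-- The array

module _ {n : ℕ} .{{_ : NonZero n}} where

  +-cong-% : ∀ {a b c d} → a % n ≡ b % n → c % n ≡ d % n → (a + c) % n ≡ (b + d) % n
  +-cong-% {a} {b} {c} {d} p q =
    trans (%-distribˡ-+ a c n) (trans (cong₂ (λ x y → (x + y) % n) p q) (sym (%-distribˡ-+ b d n)))

  suc-%-% : ∀ a → suc (a % n) % n ≡ suc a % n
  suc-%-% a = +-cong-% {1} {1} refl (m%n%n≡m%n a n)

-- By `cong-%` there are only n arguments, so reaching all of 1, ..., n already means reaching each
-- value once.
record IsHeffterSequence (n : ℕ) .{{_ : NonZero n}} (γ : ℕ → ℤ) : Set where
  field
    cong-%     : ∀ {c d} → c % n ≡ d % n → γ c ≡ γ d
    bound      : ∀ c → ∣ γ c ∣ ≤ n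
    sum-bounds : ∀ c → 1 ≤ ∣ γ c ℤ.+ γ (2 + c) ∣ × ∣ γ c ℤ.+ γ (2 + c) ∣ ≤ n
    onto       : ∀ b → 1 ≤ b → b ≤ n → ∃ λ c → ∣ γ c ∣ ≡ b
    sum-onto   : ∀ b → 1 ≤ b → b ≤ n → ∃ λ c → ∣ γ c ℤ.+ γ (2 + c) ∣ ≡ b

module _ (m : ℕ) where
  private
    n : ℕ
    n = 3 + 4 * m

    -- 2 + 2 m is the inverse of 2 modulo n.
    halved : ℕ → ℕ
    halved c = c * (2 + 2 * m) % n

    halved-2+ : ∀ c → halved (2 + c) ≡ suc (halved c) % n
    halved-2+ c = trans (%-congˡ {o = n} (arith c m))
      (trans ([m+n]%n≡m%n (suc (c * (2 + 2 * m))) n) (sym (suc-%-% {n} (c * (2 + 2 * m)))))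
      where
      arith : ∀ c m → (2 + c) * (2 + 2 * m) ≡ suc (c * (2 + 2 * m)) + (3 + 4 * m)
      arith = ℕ-solve-∀

    halved-onto : ∀ {k} → k < n → halved (2 * k) ≡ k
    halved-onto {k} k<n = trans (%-congˡ {o = n} (arith k m)) (trans ([m+kn]%n≡m%n k k n) (m<n⇒m%n≡m k<n))
      where
      arith : ∀ k m → 2 * k * (2 + 2 * m) ≡ k + k * (3 + 4 * m)
      arith = ℕ-solve-∀

  heffterSequence : ℕ → ℤ
  heffterSequence c = heffter m (halved c)

  private
    sum≡ : ∀ c → heffterSequence c ℤ.+ heffterSequence (2 + c) ≡ heffter-sum m (halved c)
    sum≡ c = cong (λ k → heffterSequence c ℤ.+ heffter m k) (halved-2+ c)

  isHeffterSequence : IsHeffterSequence (3 + 4 * m) heffterSequence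
  isHeffterSequence = record
    { cong-%     = λ {c} {d} eq → cong (heffter m) (trans (%-distribˡ-* c (2 + 2 * m) n)
        (trans (cong (λ x → x * ((2 + 2 * m) % n) % n) eq) (sym (%-distribˡ-* d (2 + 2 * m) n))))
    ; bound      = λ c → ∣heffter∣-≤ m (halved c) (m%n<n (c * (2 + 2 * m)) n)
    ; sum-bounds = λ c → subst (λ z → 1 ≤ ∣ z ∣ × ∣ z ∣ ≤ n) (sym (sum≡ c))
        (∣heffter-sum∣-bounds m (halved c) (m%n<n (c * (2 + 2 * m)) n))
    ; onto       = λ b 1≤b b≤n → let k , k<n , eq = ∣heffter∣-onto m b 1≤b b≤n in
        2 * k , trans (cong (λ k → ∣ heffter m k ∣) (halved-onto k<n)) eq
    ; sum-onto   = λ b 1≤b b≤n → let k , k<n , eq = ∣heffter-sum∣-onto m b 1≤b b≤n in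
        2 * k , trans (cong ∣_∣ (sum≡ (2 * k))) (trans (cong (λ k → ∣ heffter-sum m k ∣) (halved-onto k<n)) eq)
    }

∣i∣≡a⇒i≡±a : ∀ i {a} → ∣ i ∣ ≡ a → i ≡ + a ⊎ i ≡ ℤ.- + a
∣i∣≡a⇒i≡±a (+ _)    refl = inj₁ refl
∣i∣≡a⇒i≡±a -[1+ _ ] refl = inj₂ refl

∣i∣≤a⇒-a≤i : ∀ i {a} → ∣ i ∣ ≤ a → ℤ.- + a ℤ.≤ i
∣i∣≤a⇒-a≤i (+ b)    _         = ℤ.≤-trans (ℤ.neg-mono-≤ (+≤+ z≤n)) (+≤+ z≤n)
∣i∣≤a⇒-a≤i -[1+ b ] (s≤s b≤a) = -≤- b≤a

∣i∣≤a⇒i≤a : ∀ i {a} → ∣ i ∣ ≤ a → i ℤ.≤ + a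
∣i∣≤a⇒i≤a (+ b)    b≤a = +≤+ b≤a
∣i∣≤a⇒i≤a -[1+ b ] _   = -≤+

map-rotate : ∀ {a b} {A : Set a} {B : Set b} (f : A → B) k xs → rotate k (List.map f xs) ≡ List.map f (rotate k xs)
map-rotate f k xs = trans (cong₂ _++_ (List.drop-map k xs) (List.take-map k xs))
  (sym (List.map-++ f (drop k xs) (take k xs)))

record IsHeffterLine {v : ℕ} .{{_ : NonZero v}} (xs : List (ℤ/ v)) : Set where
  field
    length-7    : length xs ≡ 7
    sum         : ∑ xs ≡ 𝟘
    integer-sum : ∑ℤ (List.map toℤ xs) ≡ ℤ.0ℤ
    simple-line : Simple xs
open IsHeffterLine

-- Entries, line sums and bounds

module Construction {n v : ℕ} .{{_ : NonZero n}} .{{_ : NonZero v}} (7≤n : 7 ≤ n) (v≡ : v ≡ modulus n 7 7)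
  (γ : ℕ → ℤ) (γ-heffter : IsHeffterSequence n γ) where
  module γ = IsHeffterSequence γ-heffter

  private
    N : ℤ
    N = + n

  φ : ℕ → ℤ
  φ c = + (c % n)

  entry : ℕ → ℕ → ℤ
  entry 0 c = ℤ.- (+ 3 ℤ.* N ℤ.+ + 2 ℤ.+ φ c)
  entry 1 c = + 2 ℤ.* N ℤ.+ + 1 ℤ.+ γ c
  entry 2 c = + 4 ℤ.* N ℤ.+ + 3 ℤ.+ φ c
  entry 3 c = ℤ.- (γ c ℤ.+ γ (2 + c))
  entry 4 c = + 5 ℤ.* N ℤ.+ + 3 ℤ.+ φ (4 + c)
  entry 5 c = γ (2 + c) ℤ.- (+ 2 ℤ.* N ℤ.+ + 1)
  entry 6 c = ℤ.- (+ 6 ℤ.* N ℤ.+ + 4 ℤ.+ φ (4 + c))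
  entry _ c = + 0

  entry-cong : ∀ s {c d} → c % n ≡ d % n → entry s c ≡ entry s d
  entry-cong 0 eq = cong (λ x → ℤ.- (+ 3 ℤ.* N ℤ.+ + 2 ℤ.+ + x)) eq
  entry-cong 1 eq = cong (λ x → + 2 ℤ.* N ℤ.+ + 1 ℤ.+ x) (γ.cong-% eq)
  entry-cong 2 eq = cong (λ x → + 4 ℤ.* N ℤ.+ + 3 ℤ.+ + x) eq
  entry-cong 3 eq = cong₂ (λ x y → ℤ.- (x ℤ.+ y)) (γ.cong-% eq) (γ.cong-% (+-cong-% {a = 2} refl eq))
  entry-cong 4 eq = cong (λ x → + 5 ℤ.* N ℤ.+ + 3 ℤ.+ + x) (+-cong-% {a = 4} refl eq)
  entry-cong 5 eq = cong (λ x → x ℤ.- (+ 2 ℤ.* N ℤ.+ + 1)) (γ.cong-% (+-cong-% {a = 2} refl eq))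
  entry-cong 6 eq = cong (λ x → ℤ.- (+ 6 ℤ.* N ℤ.+ + 4 ℤ.+ + x)) (+-cong-% {a = 4} refl eq)
  entry-cong (suc (suc (suc (suc (suc (suc (suc _))))))) _ = refl

  columnEntries rowEntries : ℕ → List ℤ
  columnEntries c = applyUpTo (λ s → entry s c) 7
  rowEntries    c = applyUpTo (λ t → entry (6 ∸ t) (t + c)) 7

  ∑-columnEntries : ∀ c → ∑ℤ (columnEntries c) ≡ ℤ.0ℤ
  ∑-columnEntries c = cancel N (φ c) (φ (4 + c)) (γ c) (γ (2 + c))
    where
    cancel : ∀ N x y g h →
      ℤ.- (+ 3 ℤ.* N ℤ.+ + 2 ℤ.+ x) ℤ.+ (+ 2 ℤ.* N ℤ.+ + 1 ℤ.+ g ℤ.+ (+ 4 ℤ.* N ℤ.+ + 3 ℤ.+ x ℤ.+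
      (ℤ.- (g ℤ.+ h) ℤ.+ (+ 5 ℤ.* N ℤ.+ + 3 ℤ.+ y ℤ.+ (h ℤ.- (+ 2 ℤ.* N ℤ.+ + 1) ℤ.+
      (ℤ.- (+ 6 ℤ.* N ℤ.+ + 4 ℤ.+ y) ℤ.+ ℤ.0ℤ)))))) ≡ ℤ.0ℤ
    cancel = ℤ-solve-∀

  -- The partners differ from those in a column: diagonals 6 and 2 share `φ (4 + c)`, diagonals 4
  -- and 0 share `φ (6 + c)`, and the centre cancels `γ (3 + c)` from diagonal 5 and `γ (5 + c)`
  -- from diagonal 1. The shared arguments agree by computation, for example 4 + (2 + c) with 6 + c.
  ∑-rowEntries : ∀ c → ∑ℤ (rowEntries c) ≡ ℤ.0ℤ
  ∑-rowEntries c = cancel N (φ (4 + c)) (φ (6 + c)) (γ (3 + c)) (γ (5 + c))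
    where
    cancel : ∀ N x y g h →
      ℤ.- (+ 6 ℤ.* N ℤ.+ + 4 ℤ.+ x) ℤ.+ (g ℤ.- (+ 2 ℤ.* N ℤ.+ + 1) ℤ.+ (+ 5 ℤ.* N ℤ.+ + 3 ℤ.+ y ℤ.+
      (ℤ.- (g ℤ.+ h) ℤ.+ (+ 4 ℤ.* N ℤ.+ + 3 ℤ.+ x ℤ.+ (+ 2 ℤ.* N ℤ.+ + 1 ℤ.+ h ℤ.+
      (ℤ.- (+ 3 ℤ.* N ℤ.+ + 2 ℤ.+ y) ℤ.+ ℤ.0ℤ)))))) ≡ ℤ.0ℤ
    cancel = ℤ-solve-∀

  private
    _∈_ : ℤ → Interval → Set
    z ∈ I = _∈ᴵ_ n z I

  0≤n-1-φ : ∀ c → ℤ.0ℤ ℤ.≤ N ℤ.- (+ 1 ℤ.+ φ c)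
  0≤n-1-φ c = ℤ.i≤j⇒0≤j-i (+≤+ (m%n<n c n))

  0≤n+γ : ∀ c → ℤ.0ℤ ℤ.≤ γ c ℤ.- ℤ.- N
  0≤n+γ c = ℤ.i≤j⇒0≤j-i (∣i∣≤a⇒-a≤i (γ c) (γ.bound c))

  0≤n-γ : ∀ c → ℤ.0ℤ ℤ.≤ N ℤ.- γ c
  0≤n-γ c = ℤ.i≤j⇒0≤j-i (∣i∣≤a⇒i≤a (γ c) (γ.bound c))

  0≤φ : ∀ c → ℤ.0ℤ ℤ.≤ φ c
  0≤φ c = +≤+ z≤n

  entry₀∈ : ∀ c → entry 0 c ∈ interval₀
  entry₀∈ c = ≤-from-difference (0≤n-1-φ c) (lower N (φ c)) , ≤-from-difference (0≤φ c) (upper N (φ c))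
    where
    lower : ∀ N x → ℤ.- (+ 3 ℤ.* N ℤ.+ + 2 ℤ.+ x) ≡ ℤ.- + 1 ℤ.+ ℤ.- + 4 ℤ.* N ℤ.+ (N ℤ.- (+ 1 ℤ.+ x))
    lower = ℤ-solve-∀
    upper : ∀ N x → ℤ.- + 2 ℤ.+ ℤ.- + 3 ℤ.* N ≡ ℤ.- (+ 3 ℤ.* N ℤ.+ + 2 ℤ.+ x) ℤ.+ x
    upper = ℤ-solve-∀

  entry₁∈ : ∀ c → entry 1 c ∈ interval₁
  entry₁∈ c = ≤-from-difference (0≤n+γ c) (lower N (γ c)) , ≤-from-difference (0≤n-γ c) (upper N (γ c))
    where
    lower : ∀ N g → + 2 ℤ.* N ℤ.+ + 1 ℤ.+ g ≡ + 1 ℤ.+ + 1 ℤ.* N ℤ.+ (g ℤ.- ℤ.- N)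
    lower = ℤ-solve-∀
    upper : ∀ N g → + 1 ℤ.+ + 3 ℤ.* N ≡ + 2 ℤ.* N ℤ.+ + 1 ℤ.+ g ℤ.+ (N ℤ.- g)
    upper = ℤ-solve-∀

  entry₂∈ : ∀ c → entry 2 c ∈ interval₂
  entry₂∈ c = ≤-from-difference (0≤φ c) (lower N (φ c)) , ≤-from-difference (0≤n-1-φ c) (upper N (φ c))
    where
    lower : ∀ N x → + 4 ℤ.* N ℤ.+ + 3 ℤ.+ x ≡ + 3 ℤ.+ + 4 ℤ.* N ℤ.+ x
    lower = ℤ-solve-∀
    upper : ∀ N x → + 2 ℤ.+ + 5 ℤ.* N ≡ + 4 ℤ.* N ℤ.+ + 3 ℤ.+ x ℤ.+ (N ℤ.- (+ 1 ℤ.+ x))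
    upper = ℤ-solve-∀

  entry₄∈ : ∀ c → entry 4 c ∈ interval₄
  entry₄∈ c = ≤-from-difference (0≤φ (4 + c)) (lower N (φ (4 + c)))
            , ≤-from-difference (0≤n-1-φ (4 + c)) (upper N (φ (4 + c)))
    where
    lower : ∀ N x → + 5 ℤ.* N ℤ.+ + 3 ℤ.+ x ≡ + 3 ℤ.+ + 5 ℤ.* N ℤ.+ x
    lower = ℤ-solve-∀
    upper : ∀ N x → + 2 ℤ.+ + 6 ℤ.* N ≡ + 5 ℤ.* N ℤ.+ + 3 ℤ.+ x ℤ.+ (N ℤ.- (+ 1 ℤ.+ x))
    upper = ℤ-solve-∀

  entry₅∈ : ∀ c → entry 5 c ∈ interval₅
  entry₅∈ c = ≤-from-difference (0≤n+γ (2 + c)) (lower N (γ (2 + c)))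
            , ≤-from-difference (0≤n-γ (2 + c)) (upper N (γ (2 + c)))
    where
    lower : ∀ N g → g ℤ.- (+ 2 ℤ.* N ℤ.+ + 1) ≡ ℤ.- + 1 ℤ.+ ℤ.- + 3 ℤ.* N ℤ.+ (g ℤ.- ℤ.- N)
    lower = ℤ-solve-∀
    upper : ∀ N g → ℤ.- + 1 ℤ.+ ℤ.- + 1 ℤ.* N ≡ g ℤ.- (+ 2 ℤ.* N ℤ.+ + 1) ℤ.+ (N ℤ.- g)
    upper = ℤ-solve-∀

  entry₆∈ : ∀ c → entry 6 c ∈ interval₆
  entry₆∈ c = ≤-from-difference (0≤n-1-φ (4 + c)) (lower N (φ (4 + c)))
            , ≤-from-difference (0≤φ (4 + c)) (upper N (φ (4 + c)))
    where
    lower : ∀ N x → ℤ.- (+ 6 ℤ.* N ℤ.+ + 4 ℤ.+ x) ≡ ℤ.- + 3 ℤ.+ ℤ.- + 7 ℤ.* N ℤ.+ (N ℤ.- (+ 1 ℤ.+ x))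
    lower = ℤ-solve-∀
    upper : ∀ N x → ℤ.- + 4 ℤ.+ ℤ.- + 6 ℤ.* N ≡ ℤ.- (+ 6 ℤ.* N ℤ.+ + 4 ℤ.+ x) ℤ.+ x
    upper = ℤ-solve-∀

  -- The lower bound in `γ.sum-bounds` enters here: it keeps 0, a multiple of v, out of both central
  -- intervals.
  entry₃∈ : ∀ c → entry 3 c ∈ positiveCentre ⊎ entry 3 c ∈ negativeCentre
  entry₃∈ c = signed (entry 3 c)
    (subst (1 ≤_) (sym (ℤ.∣-i∣≡∣i∣ σ)) (proj₁ (γ.sum-bounds c)))
    (subst (_≤ n) (sym (ℤ.∣-i∣≡∣i∣ σ)) (proj₂ (γ.sum-bounds c)))
    where
    σ = γ c ℤ.+ γ (2 + c)
    as-constant : ∀ a N → a ≡ a ℤ.+ + 0 ℤ.* N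
    as-constant = ℤ-solve-∀
    as-multiple : ∀ b N → b ℤ.* N ≡ + 0 ℤ.+ b ℤ.* N
    as-multiple = ℤ-solve-∀
    signed : ∀ i → 1 ≤ ∣ i ∣ → ∣ i ∣ ≤ n → i ∈ positiveCentre ⊎ i ∈ negativeCentre
    signed i@(+ suc a) _ a≤n = inj₁
      ( subst (ℤ._≤ i) (as-constant (+ 1) N) (+≤+ (s≤s z≤n))
      , subst (i ℤ.≤_) (trans (sym (ℤ.*-identityˡ N)) (as-multiple (+ 1) N)) (+≤+ a≤n))
    signed i@(-[1+ a ]) _ a<n = inj₂
      ( subst (ℤ._≤ i) (trans (sym (ℤ.-1*i≡-i N)) (as-multiple (ℤ.- + 1) N)) (∣i∣≤a⇒-a≤i i a<n)
      , subst (i ℤ.≤_) (as-constant (ℤ.- + 1) N) (-≤- z≤n))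

  -- Rows and columns meet the diagonals in opposite cyclic orders.
  columnEntries∈ : ∀ {centre} c → entry 3 c ∈ centre → Pointwise _∈_ (columnEntries c) (lineIntervals centre)
  columnEntries∈ c p =
    entry₀∈ c ∷ entry₁∈ c ∷ entry₂∈ c ∷ p ∷ entry₄∈ c ∷ entry₅∈ c ∷ entry₆∈ c ∷ []

  rowEntries∈ : ∀ {centre} c → entry 3 (3 + c) ∈ centre →
    Pointwise _∈_ (rowEntries c) (List.reverse (lineIntervals centre))
  rowEntries∈ c p =
    entry₆∈ c ∷ entry₅∈ (1 + c) ∷ entry₄∈ (2 + c) ∷ p ∷ entry₂∈ (4 + c) ∷ entry₁∈ (5 + c) ∷ entry₀∈ (6 + c) ∷ []

  private
    half : ℕ
    half = 7 * n + 3

    v≡1+2half : v ≡ suc (half * 2)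
    v≡1+2half = trans v≡ (arith n)
      where
      arith : ∀ n → 2 * n * 7 + 7 ≡ suc ((7 * n + 3) * 2)
      arith = ℕ-solve-∀

    +half : + half ≡ + 3 ℤ.+ + 7 ℤ.* N
    +half = trans (cong +_ (ℕ.+-comm (7 * n) 3)) (trans (ℤ.pos-+ 3 (7 * n)) (cong (λ z → + 3 ℤ.+ z) (ℤ.pos-* 7 n)))

    -half : ℤ.- + half ≡ ℤ.- + 3 ℤ.+ ℤ.- + 7 ℤ.* N
    -half = trans (cong ℤ.-_ +half) (negate N)
      where
      negate : ∀ N → ℤ.- (+ 3 ℤ.+ + 7 ℤ.* N) ≡ ℤ.- + 3 ℤ.+ ℤ.- + 7 ℤ.* N
      negate = ℤ-solve-∀

  map-toℤ-residue : ∀ {zs Is} → Pointwise _∈_ zs Is → All BoundedByHalf Is →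
    List.map toℤ (List.map (residue {v}) zs) ≡ zs
  map-toℤ-residue [] [] = refl
  map-toℤ-residue {z ∷ _} {(lo , hi) ∷ _} ((l , h) ∷ zs∈Is) ((lo-bound , hi-bound) ∷ bounds) = cong₂ _∷_
    (toℤ-residue half v≡1+2half z
      (ℤ.≤-trans (ℤ.≤-reflexive -half) (ℤ.≤-trans (≤ᴸ-sound 7≤n lo-bound) l))
      (ℤ.≤-trans (ℤ.≤-trans h (≤ᴸ-sound 7≤n hi-bound)) (ℤ.≤-reflexive (sym +half))))
    (map-toℤ-residue zs∈Is bounds)

  -- Interval membership, the zero sum and the bounds all survive rotation, and the certificate
  -- covers every rotation; hence it does not matter at which diagonal the natural ordering of a
  -- line begins.
  heffterLine : ∀ {zs Is} → Pointwise _∈_ zs Is → IsLineCertificate Is → ∑ℤ zs ≡ ℤ.0ℤ → length zs ≡ 7 →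
    ∀ {j} → j < 8 → IsHeffterLine (rotate j (List.map (residue {v}) zs))
  heffterLine {zs} {Is} zs∈Is (avoid , bounds) ∑zs≡0 len {j} j<8 =
    subst IsHeffterLine (sym (map-rotate residue j zs)) record
      { length-7    = trans (List.length-map residue (rotate j zs)) (trans (length-rotate j zs) len)
      ; sum         = trans (∑-residue (rotate j zs)) (cong residue ∑≡0)
      ; integer-sum = trans (cong ∑ℤ (map-toℤ-residue rotated∈ (All.++⁺ (All.drop⁺ j bounds) (All.take⁺ j bounds)))) ∑≡0
      ; simple-line = simple 7≤n v≡ rotated∈ (avoid j<) ∑≡0
      }
    where
    rotated∈ : Pointwise _∈_ (rotate j zs) (rotate j Is)
    rotated∈ = Pointwise-rotate j zs∈Is
    ∑≡0 : ∑ℤ (rotate j zs) ≡ ℤ.0ℤ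
    ∑≡0 = trans (∑ℤ-rotate j zs) ∑zs≡0
    j< : j < suc (length Is)
    j< = subst (λ k → j < suc k) (trans (sym len) (Pointwise.Pointwise-length zs∈Is)) j<8

  line-with-centre : ∀ {zs is⁺ is⁻ z} → IsLineCertificate is⁺ → IsLineCertificate is⁻ →
    z ∈ positiveCentre ⊎ z ∈ negativeCentre →
    (z ∈ positiveCentre → Pointwise _∈_ zs is⁺) → (z ∈ negativeCentre → Pointwise _∈_ zs is⁻) →
    ∑ℤ zs ≡ ℤ.0ℤ → length zs ≡ 7 → ∀ {j} → j < 8 → IsHeffterLine (rotate j (List.map (residue {v}) zs))
  line-with-centre cert⁺ _ (inj₁ p) zs∈ _ = heffterLine (zs∈ p) cert⁺
  line-with-centre _ cert⁻ (inj₂ p) _ zs∈ = heffterLine (zs∈ p) cert⁻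

  columnLine : ∀ c {j} → j < 8 → IsHeffterLine (rotate j (List.map (residue {v}) (columnEntries c)))
  columnLine c = line-with-centre column⁺ column⁻ (entry₃∈ c) (columnEntries∈ c) (columnEntries∈ c) (∑-columnEntries c) refl

  rowLine : ∀ c {j} → j < 8 → IsHeffterLine (rotate j (List.map (residue {v}) (rowEntries c)))
  rowLine c = line-with-centre row⁺ row⁻ (entry₃∈ (3 + c)) (rowEntries∈ c) (rowEntries∈ c) (∑-rowEntries c) refl

  -- Diagonals along columns and rows

  diagonal : ℕ → ℕ → ℕ
  diagonal r c = (r + (n ∸ c)) % n

  array : PFArray n (ℤ/ v)
  array r c = band 7 (λ s → residue (entry s (toℕ c))) (diagonal (toℕ r) (toℕ c))

  column-heffter : ∀ j → IsHeffterLine (column array j)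
  column-heffter j with catMaybes-shifted-band {o = n ∸ toℕ j}
    (λ s → residue {v} (entry s (toℕ j))) 7≤n (ℕ.m∸n≤m n (toℕ j))
  ... | k , k<8 , eq = subst IsHeffterLine (sym eq) (columnLine (toℕ j) k<8)

  %-+n : ∀ a → (a + n) % n ≡ a % n
  %-+n a = [m+n]%n≡m%n a n

  module _ {r c : ℕ} (r<n : r < n) (c<n : c < n) where
    private
      offset start s t : ℕ
      -- From left to right `s` falls and `t` rises cyclically with s + t ≡ 6 modulo n, so `t`
      -- numbers the band in reverse. `start` is r - 6 modulo n, the column where the row meets
      -- diagonal 6. Reducing `offset` modulo n gives the bound o ≤ n that `catMaybes-shifted-band`
      -- asks for.
      offset = (n ∸ r + 6) % n
      start  = r + (n ∸ 6)
      s      = diagonal r c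
      t      = (c + offset) % n

      open ≡-Reasoning

      s+t≡6 : (s + t) % n ≡ 6
      s+t≡6 = begin
        (s + t) % n
          ≡⟨ +-cong-% {n} (m%n%n≡m%n (r + (n ∸ c)) n)
               (trans (m%n%n≡m%n (c + offset) n) (+-cong-% {n} {c} refl (m%n%n≡m%n (n ∸ r + 6) n))) ⟩
        (r + (n ∸ c) + (c + (n ∸ r + 6))) % n
          ≡⟨ %-congˡ (arith r (n ∸ c) c (n ∸ r)) ⟩
        (6 + (c + (n ∸ c)) + (r + (n ∸ r))) % n
          ≡⟨ %-congˡ (cong₂ (λ a b → 6 + a + b) (ℕ.m+[n∸m]≡n (ℕ.<⇒≤ c<n)) (ℕ.m+[n∸m]≡n (ℕ.<⇒≤ r<n))) ⟩
        (6 + n + n) % n   ≡⟨ %-+n (6 + n) ⟩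
        (6 + n) % n       ≡⟨ %-+n 6 ⟩
        6 % n             ≡⟨ m<n⇒m%n≡m 7≤n ⟩
        6 ∎
        where
        arith : ∀ r c′ c r′ → r + c′ + (c + (r′ + 6)) ≡ 6 + (c + c′) + (r + r′)
        arith = ℕ-solve-∀

      t+start≡c : (t + start) % n ≡ c % n
      t+start≡c = begin
        (t + start) % n
          ≡⟨ +-cong-% {n} (trans (m%n%n≡m%n (c + offset) n) (+-cong-% {n} {c} refl (m%n%n≡m%n (n ∸ r + 6) n))) refl ⟩
        (c + (n ∸ r + 6) + (r + (n ∸ 6))) % n
          ≡⟨ %-congˡ (arith c (n ∸ r) r (n ∸ 6)) ⟩
        (c + (r + (n ∸ r)) + (6 + (n ∸ 6))) % n
          ≡⟨ %-congˡ (cong₂ (λ a b → c + a + b) (ℕ.m+[n∸m]≡n (ℕ.<⇒≤ r<n)) (ℕ.m+[n∸m]≡n (ℕ.<⇒≤ 7≤n))) ⟩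
        (c + n + n) % n   ≡⟨ %-+n (c + n) ⟩
        (c + n) % n       ≡⟨ %-+n c ⟩
        c % n ∎
        where
        arith : ∀ c r′ r n′ → c + (r′ + 6) + (r + n′) ≡ c + (r + r′) + (6 + n′)
        arith = ℕ-solve-∀

      -- Since s ≤ 6 and t < n, the sum stays below n + 6, the next number congruent to 6.
      s<7⇒s+t≡6 : ∀ {s t} → s < 7 → t < n → (s + t) % n ≡ 6 → s + t ≡ 6
      s<7⇒s+t≡6 {s} {t} s<7 t<n eq with ℕ.<-≤-connex (s + t) n
      ... | inj₁ s+t<n = trans (sym (m<n⇒m%n≡m s+t<n)) eq
      ... | inj₂ n≤s+t with ℕ.m≤n⇒∃[o]m+o≡n n≤s+t
      ...   | d , n+d≡s+t = contradiction d≡6 (ℕ.<⇒≢ d<6)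
        where
        d<6 : d < 6
        d<6 = ℕ.+-cancelˡ-< n d 6
          (subst₂ _<_ (sym n+d≡s+t) (ℕ.+-comm 6 n) (ℕ.+-mono-≤-< (s≤s⁻¹ s<7) t<n))
        d≡6 : d ≡ 6
        d≡6 = begin
          d            ≡⟨ m<n⇒m%n≡m (ℕ.<-trans d<6 (ℕ.<-≤-trans (ℕ.n<1+n 6) 7≤n)) ⟨
          d % n        ≡⟨ %-+n d ⟨
          (d + n) % n  ≡⟨ %-congˡ (trans (ℕ.+-comm d n) n+d≡s+t) ⟩
          (s + t) % n  ≡⟨ eq ⟩
          6 ∎

    row-band : band 7 (λ s → residue {v} (entry s c)) s
             ≡ band 7 (λ t → residue (entry (6 ∸ t) (t + start))) t
    row-band with ℕ.<-≤-connex s 7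
    ... | inj₁ s<7 = begin
      band 7 (λ s → residue (entry s c)) s
        ≡⟨ band-< (λ s → residue (entry s c)) s<7 ⟩
      just (residue (entry s c))
        ≡⟨ cong (λ z → just (residue {v} z)) (trans (cong (λ s → entry s c) s≡6∸t) (entry-cong (6 ∸ t) (sym t+start≡c))) ⟩
      just (residue (entry (6 ∸ t) (t + start)))
        ≡⟨ band-< (λ t → residue (entry (6 ∸ t) (t + start))) (s≤s (subst (t ≤_) s+t (ℕ.m≤n+m t s))) ⟨
      band 7 (λ t → residue (entry (6 ∸ t) (t + start))) t ∎
      where
      s+t : s + t ≡ 6
      s+t = s<7⇒s+t≡6 s<7 (m%n<n (c + offset) n) s+t≡6
      s≡6∸t : s ≡ 6 ∸ t
      s≡6∸t = trans (sym (ℕ.m+n∸n≡m s t)) (cong (_∸ t) s+t)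
    -- The same argument with `s` and `t` exchanged: t < 7 would force s ≤ 6.
    ... | inj₂ 7≤s = trans (band-≥ (λ s → residue (entry s c)) 7≤s)
      (sym (band-≥ (λ t → residue (entry (6 ∸ t) (t + start))) (ℕ.≮⇒≥ λ t<7 →
        ℕ.<⇒≱ (s≤s (subst (s ≤_)
          (s<7⇒s+t≡6 t<7 (m%n<n (r + (n ∸ c)) n) (trans (%-congˡ (ℕ.+-comm t s)) s+t≡6)) (ℕ.m≤n+m s t))) 7≤s)))

  row-heffter : ∀ i → IsHeffterLine (row array i)
  row-heffter i with catMaybes-shifted-band {o = (n ∸ toℕ i + 6) % n}
    (λ t → residue {v} (entry (6 ∸ t) (t + (toℕ i + (n ∸ 6))))) 7≤n (m%n≤n (n ∸ toℕ i + 6) n)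
  ... | k , k<8 , eq = subst IsHeffterLine
    (sym (trans (cong catMaybes (List.tabulate-cong λ j → row-band (toℕ<n i) (toℕ<n j))) eq))
    (rowLine (toℕ i + (n ∸ 6)) k<8)

  diagonal-% : ∀ {r c} → r < n → c < n → (diagonal r c + c) % n ≡ r
  diagonal-% {r} {c} r<n c<n = begin
    (diagonal r c + c) % n    ≡⟨ +-cong-% {n} (m%n%n≡m%n (r + (n ∸ c)) n) refl ⟩
    (r + (n ∸ c) + c) % n     ≡⟨ %-congˡ (trans (ℕ.+-assoc r (n ∸ c) c) (cong (_+_ r) (ℕ.m∸n+n≡m (ℕ.<⇒≤ c<n)))) ⟩
    (r + n) % n               ≡⟨ %-+n r ⟩
    r % n                     ≡⟨ m<n⇒m%n≡m r<n ⟩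
    r ∎
    where open ≡-Reasoning

  diagonal-+ : ∀ {s c} → s < 7 → c < n → diagonal ((s + c) % n) c ≡ s
  diagonal-+ {s} {c} s<7 c<n = begin
    ((s + c) % n + (n ∸ c)) % n  ≡⟨ +-cong-% {n} (m%n%n≡m%n (s + c) n) refl ⟩
    (s + c + (n ∸ c)) % n        ≡⟨ %-congˡ (trans (ℕ.+-assoc s c (n ∸ c)) (cong (_+_ s) (ℕ.m+[n∸m]≡n (ℕ.<⇒≤ c<n)))) ⟩
    (s + n) % n                  ≡⟨ %-+n s ⟩
    s % n                        ≡⟨ m<n⇒m%n≡m (ℕ.<-≤-trans s<7 7≤n) ⟩
    s ∎
    where open ≡-Reasoning

  array-on-diagonal : ∀ {r c : Fin n} {s} → s < 7 → toℕ r ≡ (s + toℕ c) % n →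
    array r c ≡ just (residue (entry s (toℕ c)))
  array-on-diagonal {r} {c} {s} s<7 eq = trans
    (cong (band 7 (λ s → residue (entry s (toℕ c))))
      (trans (cong (λ r → diagonal r (toℕ c)) eq) (diagonal-+ s<7 (toℕ<n c))))
    (band-< (λ s → residue (entry s (toℕ c))) s<7)

  cyclically-diagonal : CyclicallyDiagonal 7 array
  cyclically-diagonal = 7≤n , zeroth , λ r c → mk⇔ (to r c) (from r c)
    where
    0<n : 0 < n
    0<n = ℕ.<-≤-trans z<s 7≤n
    zeroth : Fin n
    zeroth = fromℕ< 0<n
    shift : ∀ s c → (toℕ zeroth + s + c) % n ≡ (s + c) % n
    shift s c = cong (λ i → (i + s + c) % n) (toℕ-fromℕ< 0<n)
    filled⇒< : ∀ {a} {A : Set a} (e : ℕ → A) s → Is-just (band 7 e s) → s < 7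
    filled⇒< e s filled = ℕ.≰⇒> λ 7≤s → contradiction (subst Is-just (band-≥ e 7≤s) filled) λ ()
    to : ∀ r c → Is-just (array r c) → ∃ λ s → s < 7 × D (toℕ zeroth + s) r c
    to r c filled = diagonal (toℕ r) (toℕ c)
      , filled⇒< (λ s → residue (entry s (toℕ c))) (diagonal (toℕ r) (toℕ c)) filled
      , sym (trans (shift (diagonal (toℕ r) (toℕ c)) (toℕ c)) (diagonal-% (toℕ<n r) (toℕ<n c)))
    from : ∀ r c → (∃ λ s → s < 7 × D (toℕ zeroth + s) r c) → Is-just (array r c)
    from r c (s , s<7 , eq) = subst Is-just
      (sym (array-on-diagonal s<7 (trans eq (shift s (toℕ c))))) (just tt)

  entry-occurs : ∀ {s} c → s < 7 → (array occurs) (residue (entry s c))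
  entry-occurs {s} c s<7 = row# , column# , trans
    (array-on-diagonal s<7 (trans (toℕ-fromℕ< (m%n<n (s + c) n)) (+-cong-% {n} {s} refl (sym column#≡c))))
    (cong (just ∘ residue) (entry-cong s column#≡c))
    where
    row# column# : Fin n
    row#    = fromℕ< (m%n<n (s + c) n)
    column# = fromℕ< (m%n<n c n)
    column#≡c : toℕ column# % n ≡ c % n
    column#≡c = trans (%-congˡ (toℕ-fromℕ< (m%n<n c n))) (m%n%n≡m%n c n)

  -- Covering the residues outside J

  Covered : ℕ → Set
  Covered a = ∃₂ λ s c → s < 7 × (entry s c ≡ + a ⊎ entry s c ≡ ℤ.- + a)

  private
    φ-< : ∀ {d} → d < n → φ d ≡ + d
    φ-< d<n = cong +_ (m<n⇒m%n≡m d<n)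

    -- Diagonals 4 and 6 read `φ` at 4 + c and diagonal 5 reads `γ` at 2 + c; the column that holds
    -- a prescribed value is found by shifting back modulo n.
    unshift : ∀ k d → k ≤ n → (k + (d + (n ∸ k))) % n ≡ d % n
    unshift k d k≤n = trans (%-congˡ (trans (arith k d (n ∸ k)) (cong (_+_ d) (ℕ.m+[n∸m]≡n k≤n)))) (%-+n d)
      where
      arith : ∀ k d k′ → k + (d + k′) ≡ d + (k + k′)
      arith = ℕ-solve-∀

    affine : ∀ p q d → + p ℤ.* N ℤ.+ + q ℤ.+ + d ≡ + (p * n + q + d)
    affine p q d = sym (trans (ℤ.pos-+ (p * n + q) d)
      (cong (λ z → z ℤ.+ + d) (trans (ℤ.pos-+ (p * n) q) (cong (λ z → z ℤ.+ + q) (ℤ.pos-* p n)))))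

    affine₀ : ∀ p q → + p ℤ.* N ℤ.+ + q ≡ + (p * n + q)
    affine₀ p q = sym (trans (ℤ.pos-+ (p * n) q) (cong (λ z → z ℤ.+ + q) (ℤ.pos-* p n)))

  covered₀ : ∀ {d} → d < n → Covered (3 * n + 2 + d)
  covered₀ {d} d<n = 0 , d , from-yes (1 ℕ.≤? 7) , inj₂ (cong ℤ.-_
    (trans (cong (λ z → + 3 ℤ.* N ℤ.+ + 2 ℤ.+ z) (φ-< d<n)) (affine 3 2 d)))

  covered₂ : ∀ {d} → d < n → Covered (4 * n + 3 + d)
  covered₂ {d} d<n = 2 , d , from-yes (3 ℕ.≤? 7) , inj₁
    (trans (cong (λ z → + 4 ℤ.* N ℤ.+ + 3 ℤ.+ z) (φ-< d<n)) (affine 4 3 d))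

  φ-4+ : ∀ {d} → d < n → φ (4 + (d + (n ∸ 4))) ≡ + d
  φ-4+ {d} d<n = trans (cong +_ (unshift 4 d (ℕ.≤-trans (from-yes (4 ℕ.≤? 7)) 7≤n))) (φ-< d<n)

  covered₄ : ∀ {d} → d < n → Covered (5 * n + 3 + d)
  covered₄ {d} d<n = 4 , d + (n ∸ 4) , from-yes (5 ℕ.≤? 7) , inj₁
    (trans (cong (λ z → + 5 ℤ.* N ℤ.+ + 3 ℤ.+ z) (φ-4+ d<n)) (affine 5 3 d))

  covered₆ : ∀ {d} → d < n → Covered (6 * n + 4 + d)
  covered₆ {d} d<n = 6 , d + (n ∸ 4) , from-yes (7 ℕ.≤? 7) , inj₂ (cong ℤ.-_
    (trans (cong (λ z → + 6 ℤ.* N ℤ.+ + 4 ℤ.+ z) (φ-4+ d<n)) (affine 6 4 d)))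

  covered₃ : ∀ {b} → 1 ≤ b → b ≤ n → Covered b
  covered₃ {b} 1≤b b≤n with γ.sum-onto b 1≤b b≤n
  ... | c , eq = 3 , c , from-yes (4 ℕ.≤? 7)
    , ∣i∣≡a⇒i≡±a (entry 3 c) (trans (ℤ.∣-i∣≡∣i∣ (γ c ℤ.+ γ (2 + c))) eq)

  private
    entry₅-unshifted : ∀ c → entry 5 (c + (n ∸ 2)) ≡ γ c ℤ.- + (2 * n + 1)
    entry₅-unshifted c = cong₂ ℤ._-_
      (γ.cong-% (unshift 2 c (ℕ.≤-trans (from-yes (2 ℕ.≤? 7)) 7≤n))) (affine₀ 2 1)

    entry₁≡ : ∀ c → entry 1 c ≡ + (2 * n + 1) ℤ.+ γ c
    entry₁≡ c = cong (λ z → z ℤ.+ γ c) (affine₀ 2 1)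

  -- Each value of γ produces 2n + 1 + γ on diagonal 1 and, up to sign, 2n + 1 - γ on diagonal 5.
  -- Both 2n + 1 + ∣γ∣ and 2n + 1 - ∣γ∣ therefore occur, and the sign of γ decides which lies on
  -- which diagonal; `covered-below` treats the second one.
  covered-above : ∀ {b} → 1 ≤ b → b ≤ n → Covered (2 * n + 1 + b)
  covered-above {b} 1≤b b≤n with γ.onto b 1≤b b≤n
  ... | c , eq with ∣i∣≡a⇒i≡±a (γ c) eq
  ...   | inj₁ γ≡b  = 1 , c , from-yes (2 ℕ.≤? 7) , inj₁
    (trans (entry₁≡ c) (trans (cong (λ z → + (2 * n + 1) ℤ.+ z) γ≡b) (sym (ℤ.pos-+ (2 * n + 1) b))))
  ...   | inj₂ γ≡-b = 5 , c + (n ∸ 2) , from-yes (6 ℕ.≤? 7) , inj₂ (begin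
    entry 5 (c + (n ∸ 2))         ≡⟨ entry₅-unshifted c ⟩
    γ c ℤ.- + (2 * n + 1)         ≡⟨ cong (λ z → z ℤ.- + (2 * n + 1)) γ≡-b ⟩
    ℤ.- + b ℤ.- + (2 * n + 1)     ≡⟨ regroup (+ b) (+ (2 * n + 1)) ⟩
    ℤ.- (+ (2 * n + 1) ℤ.+ + b)   ≡⟨ cong ℤ.-_ (ℤ.pos-+ (2 * n + 1) b) ⟨
    ℤ.- + (2 * n + 1 + b) ∎)
    where
    open ≡-Reasoning
    regroup : ∀ b w → ℤ.- b ℤ.- w ≡ ℤ.- (w ℤ.+ b)
    regroup = ℤ-solve-∀

  covered-below : ∀ {a b} → 1 ≤ b → b ≤ n → a + b ≡ 2 * n + 1 → Covered a
  covered-below {a} {b} 1≤b b≤n a+b≡ with γ.onto b 1≤b b≤n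
  ... | c , eq with ∣i∣≡a⇒i≡±a (γ c) eq
  ...   | inj₁ γ≡b  = 5 , c + (n ∸ 2) , from-yes (6 ℕ.≤? 7) , inj₂ (begin
    entry 5 (c + (n ∸ 2))         ≡⟨ entry₅-unshifted c ⟩
    γ c ℤ.- + (2 * n + 1)         ≡⟨ cong₂ (λ z w → z ℤ.- + w) γ≡b (sym a+b≡) ⟩
    + b ℤ.- + (a + b)             ≡⟨ cong (λ z → + b ℤ.- z) (ℤ.pos-+ a b) ⟩
    + b ℤ.- (+ a ℤ.+ + b)         ≡⟨ regroup (+ a) (+ b) ⟩
    ℤ.- + a ∎)
    where
    open ≡-Reasoning
    regroup : ∀ a b → b ℤ.- (a ℤ.+ b) ≡ ℤ.- a
    regroup = ℤ-solve-∀
  ...   | inj₂ γ≡-b = 1 , c , from-yes (2 ℕ.≤? 7) , inj₁ (begin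
    entry 1 c                     ≡⟨ entry₁≡ c ⟩
    + (2 * n + 1) ℤ.+ γ c         ≡⟨ cong₂ (λ w z → + w ℤ.+ z) (sym a+b≡) γ≡-b ⟩
    + (a + b) ℤ.- + b             ≡⟨ cong (λ z → z ℤ.- + b) (ℤ.pos-+ a b) ⟩
    + a ℤ.+ + b ℤ.- + b           ≡⟨ regroup (+ a) (+ b) ⟩
    + a ∎)
    where
    open ≡-Reasoning
    regroup : ∀ a b → a ℤ.+ b ℤ.- b ≡ a
    regroup = ℤ-solve-∀

  private
    <⊎≥ : ∀ d → d < n ⊎ ∃ λ e → n + e ≡ d
    <⊎≥ d with ℕ.<-≤-connex d n
    ... | inj₁ d<n = inj₁ d<n
    ... | inj₂ n≤d = inj₂ (ℕ.m≤n⇒∃[o]m+o≡n n≤d)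

  -- Without the multiples of 2n + 1, the numbers 1, ..., 7n + 3 form seven blocks of length n, with
  -- one multiple after every second block. In increasing order the blocks belong to diagonal 3, to
  -- 1 and 5 jointly (two blocks, on either side of 2n + 1), and to 0, 2, 4, 6. The case split
  -- removes one block or one multiple at a time.
  covered : ∀ a → a ≤ half → ¬ (2 * n + 1 ∣ a) → Covered a
  covered zero    _  nd = contradiction (divides 0 refl) nd
  covered (suc d) a≤ nd with <⊎≥ d
  ... | inj₁ d<n = covered₃ (s≤s z≤n) d<n
  ... | inj₂ (e , refl) with <⊎≥ e
  ...   | inj₁ e<n with ℕ.m≤n⇒∃[o]m+o≡n e<n
  ...     | i , eq = covered-below {b = suc i} (s≤s z≤n) (≤-from-complement e (trans (arith i e) eq))
    (trans (arith′ n e i) (trans (cong (λ x → n + x + 1) eq) (arith″ n)))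
    where
    arith : ∀ i e → suc i + e ≡ suc e + i
    arith = ℕ-solve-∀
    arith′ : ∀ n e i → suc (n + e) + suc i ≡ n + (suc e + i) + 1
    arith′ = ℕ-solve-∀
    arith″ : ∀ n → n + n + 1 ≡ 2 * n + 1
    arith″ = ℕ-solve-∀
  covered (suc _) a≤ nd | inj₂ (_ , refl) | inj₂ (zero , refl) = contradiction (divides 1 (arith n)) nd
    where
    arith : ∀ n → suc (n + (n + 0)) ≡ 1 * (2 * n + 1)
    arith = ℕ-solve-∀
  covered (suc _) a≤ nd | inj₂ (_ , refl) | inj₂ (suc e , refl) with <⊎≥ e
  ... | inj₁ e<n = subst Covered (arith n e) (covered-above (s≤s z≤n) e<n)
    where
    arith : ∀ n e → 2 * n + 1 + suc e ≡ suc (n + (n + suc e))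
    arith = ℕ-solve-∀
  ... | inj₂ (f , refl) with <⊎≥ f
  ...   | inj₁ f<n = subst Covered (arith n f) (covered₀ f<n)
    where
    arith : ∀ n f → 3 * n + 2 + f ≡ suc (n + (n + suc (n + f)))
    arith = ℕ-solve-∀
  ...   | inj₂ (zero , refl) = contradiction (divides 2 (arith n)) nd
    where
    arith : ∀ n → suc (n + (n + suc (n + (n + 0)))) ≡ 2 * (2 * n + 1)
    arith = ℕ-solve-∀
  ...   | inj₂ (suc g , refl) with <⊎≥ g
  ...     | inj₁ g<n = subst Covered (arith n g) (covered₂ g<n)
    where
    arith : ∀ n g → 4 * n + 3 + g ≡ suc (n + (n + suc (n + (n + suc g))))
    arith = ℕ-solve-∀
  ...     | inj₂ (h , refl) with <⊎≥ h
  ...       | inj₁ h<n = subst Covered (arith n h) (covered₄ h<n)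
    where
    arith : ∀ n h → 5 * n + 3 + h ≡ suc (n + (n + suc (n + (n + suc (n + h)))))
    arith = ℕ-solve-∀
  ...       | inj₂ (zero , refl) = contradiction (divides 3 (arith n)) nd
    where
    arith : ∀ n → suc (n + (n + suc (n + (n + suc (n + (n + 0)))))) ≡ 3 * (2 * n + 1)
    arith = ℕ-solve-∀
  -- The last block is closed by the bound: a ≤ 7n + 3 gives i < n.
  ...       | inj₂ (suc i , refl) = subst Covered (arith n i) (covered₆ (ℕ.+-cancelˡ-≤ (6 * n + 3) (suc i) n
    (subst₂ _≤_ (arith′ n i) (arith″ n) a≤)))
    where
    arith : ∀ n i → 6 * n + 4 + i ≡ suc (n + (n + suc (n + (n + suc (n + (n + suc i))))))
    arith = ℕ-solve-∀
    arith′ : ∀ n i → suc (n + (n + suc (n + (n + suc (n + (n + suc i)))))) ≡ 6 * n + 3 + suc i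
    arith′ = ℕ-solve-∀
    arith″ : ∀ n → 7 * n + 3 ≡ 6 * n + 3 + n
    arith″ = ℕ-solve-∀

  array-covers : ∀ (x : ℤ/ v) → ¬ (2 * n + 1 ∣ toℕ x) → (array occurs) x ⊎ (array occurs) (⊖ x)
  array-covers x nd with ≤⊎> half (toℕ x)
  ... | inj₁ (d , eq) with covered (toℕ x) (≤-from-complement d eq) nd
  ...   | s , c , s<7 , inj₁ e = inj₁ (subst (array occurs) (trans (cong residue e) (residue-toℕ x)) (entry-occurs c s<7))
  ...   | s , c , s<7 , inj₂ e = inj₂ (subst (array occurs) (trans (cong residue e) (sym (⊖-residue x))) (entry-occurs c s<7))
  -- In the upper half the argument runs with b = v - x, the representative of `⊖ x`, and the two
  -- signs change roles. As 2n + 1 divides v = 7 (2n + 1), b is no multiple of 2n + 1 either.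
  array-covers x nd | inj₂ (d , eq) = by-complement (covered b b≤half nd′)
    where
    b = v ∸ toℕ x
    b+x≡v : b + toℕ x ≡ v
    b+x≡v = ℕ.m∸n+n≡m (ℕ.<⇒≤ (toℕ<n x))
    b≤half : b ≤ half
    b≤half = ≤-from-complement d (ℕ.+-cancelʳ-≡ (suc half) (b + d) half (begin
      b + d + suc half     ≡⟨ arith b d half ⟩
      b + (suc half + d)   ≡⟨ cong (_+_ b) eq ⟩
      b + toℕ x            ≡⟨ trans b+x≡v v≡1+2half ⟩
      suc (half * 2)       ≡⟨ arith′ half ⟩
      half + suc half ∎))
      where
      open ≡-Reasoning
      arith : ∀ b d h → b + d + suc h ≡ b + (suc h + d)
      arith = ℕ-solve-∀
      arith′ : ∀ h → suc (h * 2) ≡ h + suc h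
      arith′ = ℕ-solve-∀
    nd′ : ¬ (2 * n + 1 ∣ b)
    nd′ div = nd (∣m+n∣m⇒∣n (subst (2 * n + 1 ∣_) (sym b+x≡v) (divides 7 (trans v≡ (arith n)))) div)
      where
      arith : ∀ n → 2 * n * 7 + 7 ≡ 7 * (2 * n + 1)
      arith = ℕ-solve-∀
    -b≡x-v : ℤ.- + b ≡ + toℕ x ℤ.+ ℤ.- + 1 ℤ.* + v
    -b≡x-v = trans (regroup (+ b) (+ toℕ x))
      (cong (λ z → + toℕ x ℤ.+ ℤ.- + 1 ℤ.* z) (trans (sym (ℤ.pos-+ b (toℕ x))) (cong +_ b+x≡v)))
      where
      regroup : ∀ b x → ℤ.- b ≡ x ℤ.+ ℤ.- + 1 ℤ.* (b ℤ.+ x)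
      regroup = ℤ-solve-∀
    by-complement : Covered b → (array occurs) x ⊎ (array occurs) (⊖ x)
    by-complement (s , c , s<7 , inj₁ e) = inj₂ (subst (array occurs) (cong residue e) (entry-occurs c s<7))
    by-complement (s , c , s<7 , inj₂ e) = inj₁ (subst (array occurs)
      (trans (cong residue e) (residue-unique x (ℤ.- + 1) -b≡x-v)) (entry-occurs c s<7))

-- Assembly for n = 4m + 3

proposition4p6 : ∀ (n : ℕ) → 7 ≤ n → n % 4 ≡ 3 →
    ∃ λ (A : PFArray n (ℤ/ modulus n 7 7)) →
    IsHeffter n 7 7 A × IsInteger A × CyclicallyDiagonal 7 A × GloballySimple A
proposition4p6 n 7≤n n%4≡3 = array
  , record
      { 3≤k           = from-yes (3 ℕ.≤? 7)
      ; k≤n           = 7≤n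
      ; t∣2nk         = divides (2 * n) refl
      ; row-filled    = length-7 ∘ row-heffter
      ; column-filled = length-7 ∘ column-heffter
      ; covers        = λ x x∉J → array-covers x (x∉J ∘ subst (_∣ toℕ x) (sym v/7))
      ; row-sum       = sum ∘ row-heffter
      ; column-sum    = sum ∘ column-heffter
      }
  , (integer-sum ∘ row-heffter , integer-sum ∘ column-heffter)
  , cyclically-diagonal
  , (simple-line ∘ row-heffter , simple-line ∘ column-heffter)
  where
  m = n / 4
  n≡ : 3 + 4 * m ≡ n
  n≡ = sym (trans (m≡m%n+[m/n]*n n 4) (cong₂ _+_ n%4≡3 (ℕ.*-comm m 4)))
  n≢0 : NonZero n
  n≢0 = >-nonZero (ℕ.<-≤-trans z<s 7≤n)
  γ-heffter : IsHeffterSequence n {{n≢0}} (heffterSequence m)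
  -- As `m` is itself n / 4, the equation `n≡` cannot be matched against n; it is eliminated for a
  -- fresh `k` instead.
  γ-heffter = transport {n} {{n≢0}} n≡
    where
    transport : ∀ {k} .{{_ : NonZero k}} → 3 + 4 * m ≡ k → IsHeffterSequence k (heffterSequence m)
    transport refl = isHeffterSequence m
  open Construction {n} {modulus n 7 7} {{n≢0}} {{+-nonZeroʳ {2 * n * 7} {7}}} 7≤n refl (heffterSequence m) γ-heffter
  v/7 : modulus n 7 7 / 7 ≡ 2 * n + 1
  v/7 = trans (/-congˡ {o = 7} (arith n)) (m*n/n≡m (2 * n + 1) 7)
    where
    arith : ∀ n → 2 * n * 7 + 7 ≡ (2 * n + 1) * 7
    arith = ℕ-solve-∀
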